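{- Let $n\geq2$ and let $H$ be a skew-Bush type Hadamard matrix of order $n^2$. Let $A=(J-H)/2$, $k\in\{3,4\}$, and $a\in D_A(k)$. Then $\mathfrak H_A(n^2,k,a)$ is a $\operatorname{PBIBD}(n^2,k;\lambda_1,\lambda_2)$ on $\mathcal X_1$, where $$(\lambda_1,\lambda_2)=\begin{cases} \left(n^2-2,\ \frac{(3n-4)(n+2)}{4}\right) & \text{if }(k,a)=(3,0),\\[2pt] \left(0,\ \frac{n(n-2)}{4}\right) & \text{if }(k,a)=(3,1),\\[2pt] \left(\frac{n^4}{16},\ \frac{n^2(3n^2-10n+12)}{16}\right) & \text{if }(k,a)=(4,-1),\\[2pt] \left(\frac{(n-2)(n+2)(7n^2-12)}{16},\ \frac{(n-2)(5n^3+20n^2-12n-24)}{16}\right) & \text{if }(k,a)=(4,0). \end{cases}$$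
   Context: A (real) Hadamard matrix of order $m$ is an $m\times m$ $\{\pm1\}$-matrix $H$ with $HH^{\top}=mI$. A Hadamard matrix $H$ of order $n^2$ is skew-Bush type if, written in $n\times n$ blocks $H=(H_{ij})_{i,j=1}^n$, one has $H_{ii}=J_n$ for all $i$, and $H_{ij}J_n=J_nH_{ij}=O$ and $H_{ij}^{\top}=-H_{ji}$ for all distinct $i,j$. ($J$ denotes an all-ones matrix.) $\mathcal X_1=([n^2],\{R_0,R_1,R_2\})$ is the symmetric association scheme on $[n^2]=\{1,\dots,n^2\}$ with $R_0=\{(x,x)\}$, $R_1=\{(x,y): x\neq y,\ \lfloor (x-1)/n\rfloor=\lfloor (y-1)/n\rfloor\}$, $R_2=\{(x,y):\lfloor (x-1)/n\rfloor\neq\lfloor (y-1)/n\rfloor\}$. For a $v\times v$ matrix $A$ and $\alpha\subset[v]$, $A[\alpha]$ is the principal submatrix indexed by $\alpha$; $D_A(k)$ is the set of values $\det(A[\alpha])$ over all $k$-subsets $\alpha$ of $[v]$; $\mathfrak H_A(v,k,a)$ is the $k$-uniform hypergraph on $[v]$ whose hyperedges are the $k$-subsets $\alpha$ with $\det(A[\alpha])=a$. A $\operatorname{PBIBD}(v,k;\lambda_1,\lambda_2)$ on a scheme $([v],\{R_0,R_1,R_2\})$ is a $k$-uniform hypergraph on $[v]$ in which every vertex lies in the same positive number of hyperedges and, for $i\in\{1,2\}$ and each $(x,y)\in R_i$, the pair $\{x,y\}$ is contained in exactly $\lambda_i$ hyperedges. -}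

module Defs where

open import Data.Nat as ℕ using (ℕ; zero; suc)
open import Data.Integer as ℤ using (ℤ; +_; -[1+_]; 0ℤ; 1ℤ; -1ℤ)
open import Data.Integer.Properties using (+-0-commutativeMonoid)
open import Data.Rational as ℚ using (ℚ)
open import Data.Fin as Fin using (Fin; zero; suc; toℕ; punchIn; combine; quotient)
open import Data.Fin.Subset using (Subset; inside; outside; ∣_∣; _∈_)
open import Data.Fin.Subset.Properties using (_∈?_)
open import Data.Vec using ([]; _∷_)
open import Data.List as List using (List; length; map; filter; _++_)
open import Data.Maybe using (Maybe; just; nothing)
open import Data.Product using (_×_; _,_; proj₁; ∃-syntax)
open import Data.Sum using (_⊎_)
open import Level using (0ℓ)
open import Relation.Binary.Core using (Rel)
open import Relation.Binary.PropositionalEquality using (_≡_; _≢_)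
open import Relation.Nullary using (yes; no)
open import Relation.Nullary.Decidable using (_×-dec_)
open import Relation.Unary using (Pred; Decidable)
open import Algebra.Properties.CommutativeMonoid.Sum +-0-commutativeMonoid using (sum)

Matrix : ℕ → Set
Matrix m = Fin m → Fin m → ℤ

infix 4 _≋_
_≋_ : ∀ {m} → Matrix m → Matrix m → Set
M ≋ N = ∀ x y → M x y ≡ N x y

J O I : ∀ {m} → Matrix m
J _ _ = 1ℤ
O _ _ = 0ℤ
I x y with x Fin.≟ y
... | yes _ = 1ℤ
... | no  _ = 0ℤ

infix 8 _ᵀ
_ᵀ : ∀ {m} → Matrix m → Matrix m
(M ᵀ) x y = M y x

infixr 7 _·_ _•_
_·_ : ∀ {m} → Matrix m → Matrix m → Matrix m
(M · N) x y = sum (λ z → M x z ℤ.* N z y)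

_•_ : ∀ {m} → ℤ → Matrix m → Matrix m
(c • M) x y = c ℤ.* M x y

neg : ∀ {m} → Matrix m → Matrix m
neg M x y = ℤ.- M x y

-- Laplace expansion along the first row.
det : ∀ {m} → Matrix m → ℤ
det {zero}  M = 1ℤ
det {suc m} M =
  sum (λ j → (-1ℤ ℤ.^ toℕ j) ℤ.* M zero j ℤ.* det (λ r c → M (suc r) (punchIn j c)))

record IsHadamard {m : ℕ} (H : Matrix m) : Set where
  field
    ±1-entries : ∀ x y → H x y ≡ 1ℤ ⊎ H x y ≡ -1ℤ
    HHᵀ≋mI     : H · H ᵀ ≋ (+ m) • I

-- Rows and columns are indexed from 0, and n² is written n * n, so that
-- `combine i r` is the index n i + r, the r-th one of the i-th block.
block : ∀ n → Matrix (n ℕ.* n) → Fin n → Fin n → Matrix n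
block n H i j r s = H (combine i r) (combine j s)

record IsSkewBush (n : ℕ) (H : Matrix (n ℕ.* n)) : Set where
  field
    isHadamard : IsHadamard H
    diagonal   : ∀ i → block n H i i ≋ J
    rowSums    : ∀ i j → i ≢ j → block n H i j · J ≋ O
    colSums    : ∀ i j → i ≢ j → J · block n H i j ≋ O
    skew       : ∀ i j → i ≢ j → block n H i j ᵀ ≋ neg (block n H j i)

-- (J − H)/2. `ℤ._/_` rounds in general, but the division is exact here since
-- H has entries ±1.
[J-_]/2 : ∀ {m} → Matrix m → Matrix m
[J- H ]/2 x y = (1ℤ ℤ.- H x y) ℤ./ (+ 2)

-- The increasing enumeration of the elements of α.
elements : ∀ {v} (α : Subset v) → Fin ∣ α ∣ → Fin v
elements (inside  ∷ α) zero    = zero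
elements (inside  ∷ α) (suc i) = suc (elements α i)
elements (outside ∷ α) i       = suc (elements α i)

infix 9 _[_]
_[_] : ∀ {v} → Matrix v → (α : Subset v) → Matrix ∣ α ∣
(A [ α ]) r c = A (elements α r) (elements α c)

D : ∀ {v} → Matrix v → ℕ → Pred ℤ 0ℓ
D {v} A k a = ∃[ α ] ∣ α ∣ ≡ k × det (A [ α ]) ≡ a

record UniformHypergraph (v k : ℕ) : Set₁ where
  field
    Edge    : Pred (Subset v) 0ℓ
    edge?   : Decidable Edge
    uniform : ∀ {α} → Edge α → ∣ α ∣ ≡ k

𝓗 : ∀ {v} → Matrix v → (k : ℕ) → ℤ → UniformHypergraph v k
𝓗 A k a = record
  { Edge    = λ α → ∣ α ∣ ≡ k × det (A [ α ]) ≡ a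
  ; edge?   = λ α → (∣ α ∣ ℕ.≟ k) ×-dec (det (A [ α ]) ℤ.≟ a)
  ; uniform = proj₁
  }

-- Every subset occurs exactly once, so filtering and taking lengths counts.
subsets : ∀ v → List (Subset v)
subsets zero    = [] List.∷ List.[]
subsets (suc v) = map (outside ∷_) (subsets v) ++ map (inside ∷_) (subsets v)

module _ {v k : ℕ} (G : UniformHypergraph v k) where
  open UniformHypergraph G

  degree : Fin v → ℕ
  degree x = length (filter (λ α → edge? α ×-dec (x ∈? α)) (subsets v))

  pairDegree : Fin v → Fin v → ℕ
  pairDegree x y =
    length (filter (λ α → edge? α ×-dec ((x ∈? α) ×-dec (y ∈? α))) (subsets v))

-- The relations R₀, R₁, R₂ of a two-class scheme on [v].
Relations : ℕ → Set₁
Relations v = Fin 3 → Rel (Fin v) 0ℓ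

record IsPBIBD {v k : ℕ} (R : Relations v) (λ₁ λ₂ : ℕ)
               (G : UniformHypergraph v k) : Set where
  field
    regular : ∃[ r ] 0 ℕ.< r × (∀ x → degree G x ≡ r)
    pairs₁  : ∀ x y → R (suc zero) x y → pairDegree G x y ≡ λ₁
    pairs₂  : ∀ x y → R (suc (suc zero)) x y → pairDegree G x y ≡ λ₂

-- `quotient n x` is ⌊x/n⌋, which is ⌊(x−1)/n⌋ when indexing from 1.
𝓧₁ : ∀ n → Relations (n ℕ.* n)
𝓧₁ n zero             x y = x ≡ y
𝓧₁ n (suc zero)       x y = x ≢ y × quotient {n} n x ≡ quotient {n} n y
𝓧₁ n (suc (suc zero)) x y = quotient {n} n x ≢ quotient {n} n y

ℕ→ℚ : ℕ → ℚ
ℕ→ℚ m = (+ m) ℚ./ 1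

-- (λ₁, λ₂) as a function of (k, a). It is undefined outside the four listed
-- cases, and the division is the one of ℚ, so nothing is rounded.
parameters : (n k : ℕ) (a : ℤ) → Maybe (ℚ × ℚ)
parameters n k a = go k a
  where
  open import Data.Integer using (_+_; _-_; _*_; _^_)

  N : ℤ
  N = + n

  go : ℕ → ℤ → Maybe (ℚ × ℚ)
  go 3 (+ 0) = just
    ( (N ^ 2 - + 2) ℚ./ 1
    , ((+ 3 * N - + 4) * (N + + 2)) ℚ./ 4 )
  go 3 (+ 1) = just
    ( 0ℤ ℚ./ 1
    , (N * (N - + 2)) ℚ./ 4 )
  go 4 -[1+ 0 ] = just
    ( (N ^ 4) ℚ./ 16
    , (N ^ 2 * (+ 3 * N ^ 2 - + 10 * N + + 12)) ℚ./ 16 )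
  go 4 (+ 0) = just
    ( ((N - + 2) * (N + + 2) * (+ 7 * N ^ 2 - + 12)) ℚ./ 16
    , ((N - + 2) * (+ 5 * N ^ 3 + + 20 * N ^ 2 - + 12 * N - + 24)) ℚ./ 16 )
  go _ _ = nothing

{-# OPTIONS --safe #-}

-- Since H = 1 on the diagonal blocks and H is skew elsewhere, A = (J − H)/2 is
-- the adjacency matrix of an orientation of the complete multipartite graph
-- whose parts are the blocks. On at most four vertices an oriented graph has at
-- most one directed Hamiltonian cycle, and for |α| = k ∈ {3, 4} one has
-- det A[α] = (−1)^(k−1) or 0 according to whether A[α] has such a cycle or not.
-- Hence for the nonzero value the number of hyperedges through x and y counts
-- the closed k-walks through x and y:
--   A(x,y)A²(y,x) + A²(x,y)A(y,x)                        if k = 3,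
--   A(x,y)A³(y,x) + A²(x,y)A²(y,x) + A³(x,y)A(y,x)       if k = 4.
-- With H Hᵀ = n² I and the vanishing block row sums, A² is a combination of J,
-- the block matrix I ⊗ J and I, and A³ one of these and A, so the counts depend
-- on the relation of x and y only. The value 0 is treated by complementation.
module Submission where

open import Defs
open import Data.Bool using (true; false; if_then_else_)
open import Data.Empty using (⊥-elim)
open import Data.Fin as Fin using (Fin; zero; suc; toℕ; punchIn; combine; quotient; remainder; _↑ˡ_; _↑ʳ_)
import Data.Fin.Properties as Fin
open import Data.Fin.Subset using (Subset; inside; outside; ⊥; ⁅_⁆; _∈_; _∉_; _⊆_; _∪_; ∁; ∣_∣)
open import Data.Fin.Subset.Properties
open import Data.Integer as ℤ using (ℤ; +_; 0ℤ; 1ℤ; -1ℤ; _+_; _*_; _-_; -_; _^_)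
import Data.Integer.Properties as ℤ
open import Data.Integer.Tactic.RingSolver using (solve-∀)
open import Data.List as List using (length; filter; map)
import Data.List.Membership.Propositional as List
open import Data.List.Membership.Propositional.Properties using (∈-++⁺ˡ; ∈-++⁺ʳ; ∈-map⁺)
open import Data.List.Properties using (filter-++; length-++; filter-some)
import Data.List.Relation.Unary.Any as Any
open import Data.Maybe using (just)
open import Data.Nat as ℕ using (ℕ; zero; suc; s≤s; z≤n)
open import Data.Nat.Combinatorics using (_C_; nC1≡n; nCk+nC[k+1]≡[n+1]C[k+1])
import Data.Nat.Properties as ℕ
open import Data.Product using (_×_; _,_; proj₁; proj₂; ∃-syntax)
import Data.Rational as ℚ
open import Data.Rational.Properties using (fromℚᵘ-cong)
open import Data.Rational.Unnormalised.Base using (mkℚᵘ; *≡*)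
open import Data.Sum using (_⊎_; inj₁; inj₂; [_,_]′)
open import Data.Unit using (⊤; tt)
open import Data.Vec using (Vec; []; _∷_; here; there; lookup; tabulate)
open import Data.Vec.Properties using (lookup∘tabulate)
open import Data.Vec.Relation.Unary.All using (All; []; _∷_; all?)
open import Data.Vec.Relation.Unary.Unique.Propositional using (Unique; []; _∷_)
open import Function using (_∘_; _⇔_; mk⇔)
open import Level using (0ℓ)
open import Relation.Binary.PropositionalEquality hiding ([_])
open import Relation.Nullary using (Dec; yes; no; ¬_; does)
open import Relation.Nullary.Decidable
  using (map′; _×-dec_; _⊎-dec_; from-yes; dec-true; dec-false; does-⇔)
open import Relation.Unary as Unary using (Pred; Decidable)
open import Algebra.Properties.Semiring.Sum ℤ.+-*-semiring
  using (sum; sum-cong-≗; ∑-distrib-+; *-distribˡ-sum; *-distribʳ-sum; sum-replicate-zero)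
open ≡-Reasoning

-- Small oriented graphs

𝟙 : ∀ {p} {P : Set p} → Dec P → ℤ
𝟙 P? = if does P? then 1ℤ else 0ℤ

-- k counts the intermediate vertices, so walks M k is the power of exponent k + 1.
walks : ∀ {m} → Matrix m → ℕ → Matrix m
walks M zero    = M
walks M (suc k) = M · walks M k

walks-cong : ∀ {m} {M N : Matrix m} → M ≋ N → ∀ k → walks M k ≋ walks N k
walks-cong M≋N zero    x y = M≋N x y
walks-cong M≋N (suc k) x y =
  sum-cong-≗ λ z → cong₂ _*_ (M≋N x z) (walks-cong M≋N k z y)

det-cong : ∀ {m} {M N : Matrix m} → M ≋ N → det M ≡ det N
det-cong {zero}  M≋N = refl
det-cong {suc m} M≋N = sum-cong-≗ λ j →
  cong₂ (λ u d → (-1ℤ ^ toℕ j) * u * d) (M≋N zero j)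
    (det-cong λ r c → M≋N (suc r) (punchIn j c))

record IsOriented {m} (M : Matrix m) : Set where
  field
    entries : ∀ x y → M x y ≡ 0ℤ ⊎ M x y ≡ 1ℤ
    one-way : ∀ x y → M x y ≡ 1ℤ → M y x ≡ 0ℤ

-- Meant for `M` oriented of order `k + 1`, with `k` equal to 2 or 3 and `b` = (-1)^k. A closed walk
-- of `k + 1` steps then runs once round a Hamiltonian directed cycle, which explains why the count
-- is the same at every vertex `i`.
record DetCountsWalks {m} (k : ℕ) (b : ℤ) (M : Matrix m) : Set where
  constructor _,_
  field
    det∈   : det M ≡ 0ℤ ⊎ det M ≡ b
    counts : ∀ i → 𝟙 (det M ℤ.≟ b) ≡ walks M k i i

-- The i-th vector of a code lists the arcs between i and the later vertices:
-- none, forwards or backwards.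
Code : ℕ → Set
Code zero    = ⊤
Code (suc m) = Vec (Fin 3) m × Code m

forward backward : Fin 3 → ℤ
forward (suc zero) = 1ℤ
forward _          = 0ℤ
backward (suc (suc zero)) = 1ℤ
backward _                = 0ℤ

decode : ∀ {m} → Code m → Matrix m
decode {suc m} (c , cs) zero    zero    = 0ℤ
decode {suc m} (c , cs) zero    (suc j) = forward (lookup c j)
decode {suc m} (c , cs) (suc i) zero    = backward (lookup c i)
decode {suc m} (c , cs) (suc i) (suc j) = decode cs i j

allVec? : ∀ m {P : Pred (Vec (Fin 3) m) 0ℓ} → Decidable P → Dec (∀ c → P c)
allVec? zero    P? = map′ (λ { p [] → p }) (λ p → p []) (P? [])
allVec? (suc m) P? =
  map′ (λ { p (x ∷ c) → p x c }) (λ p x c → p (x ∷ c))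
    (Fin.all? λ x → allVec? m λ c → P? (x ∷ c))

allCode? : ∀ m {P : Pred (Code m) 0ℓ} → Decidable P → Dec (∀ c → P c)
allCode? zero    P? = map′ (λ { p tt → p }) (λ p → p tt) (P? tt)
allCode? (suc m) P? =
  map′ (λ { p (c , cs) → p c cs }) (λ p c cs → p (c , cs))
    (allVec? m λ c → allCode? m λ cs → P? (c , cs))

detCountsWalks? : ∀ {m} k b (M : Matrix m) → Dec (DetCountsWalks k b M)
detCountsWalks? k b M =
  map′ (λ (d , c) → d , c) (λ (d , c) → d , c) (((det M ℤ.≟ 0ℤ) ⊎-dec (det M ℤ.≟ b)) ×-dec
  Fin.all? (λ i → 𝟙 (det M ℤ.≟ b) ℤ.≟ walks M k i i))

code₃ : ∀ c → DetCountsWalks 2 1ℤ (decode {3} c)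
code₃ = from-yes (allCode? 3 λ c → detCountsWalks? 2 1ℤ (decode {3} c))

-- By evaluation over all 3^6 = 729 codes, one for each labelled oriented graph on four vertices.
code₄ : ∀ c → DetCountsWalks 3 -1ℤ (decode {4} c)
code₄ = from-yes (allCode? 4 λ c → detCountsWalks? 3 -1ℤ (decode {4} c))

module _ {m} {M : Matrix m} (oriented : IsOriented M) where
  open IsOriented oriented

  zero-diagonal : ∀ x → M x x ≡ 0ℤ
  zero-diagonal x with entries x x
  ... | inj₁ Mxx≡0 = Mxx≡0
  ... | inj₂ Mxx≡1 = one-way x x Mxx≡1

  no-2-cycle : ∀ x y → M x y * M y x ≡ 0ℤ
  no-2-cycle x y with entries x y
  ... | inj₁ Mxy≡0 = cong (_* M y x) Mxy≡0
  ... | inj₂ Mxy≡1 = cong₂ _*_ Mxy≡1 (one-way x y Mxy≡1)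

  arc : ∀ x y → ∃[ e ] M x y ≡ forward e × M y x ≡ backward e
  arc x y with entries x y | entries y x
  ... | inj₁ Mxy≡0 | inj₁ Myx≡0 = zero , Mxy≡0 , Myx≡0
  ... | inj₁ Mxy≡0 | inj₂ Myx≡1 = suc (suc zero) , Mxy≡0 , Myx≡1
  ... | inj₂ Mxy≡1 | _          = suc zero , Mxy≡1 , one-way x y Mxy≡1

  restrict-oriented : ∀ {l} (f : Fin l → Fin m) → IsOriented (λ i j → M (f i) (f j))
  restrict-oriented f = record
    { entries = λ i j → entries (f i) (f j) ; one-way = λ i j → one-way (f i) (f j) }

-- Makes the finite check over codes cover all oriented matrices. The agreement is entrywise, so
-- facts about `decode c` are carried back by `detCountsWalks-resp`.
encode : ∀ {m} {M : Matrix m} → IsOriented M → ∃[ c ] M ≋ decode c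
encode {zero}  oriented = tt , λ ()
encode {suc m} {M} oriented =
  let cs , M≋cs = encode (restrict-oriented oriented suc)
      a = arc oriented zero
      c = tabulate λ j → proj₁ (a (suc j))
      decoded : M ≋ decode (c , cs)
      decoded = λ
        { zero    zero    → zero-diagonal oriented zero
        ; zero    (suc j) → trans (proj₁ (proj₂ (a (suc j))))
                              (cong forward (sym (lookup∘tabulate _ j)))
        ; (suc i) zero    → trans (proj₂ (proj₂ (a (suc i))))
                              (cong backward (sym (lookup∘tabulate _ i)))
        ; (suc i) (suc j) → M≋cs i j }
  in (c , cs) , decoded

detCountsWalks-resp : ∀ {m k b} {M N : Matrix m} → M ≋ N →
                      DetCountsWalks k b N → DetCountsWalks k b M
detCountsWalks-resp {k = k} {b} {M} {N} M≋N (det∈ , counts) =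
  subst (λ d → d ≡ 0ℤ ⊎ d ≡ b) (sym M=N) det∈ ,
  λ i → begin
    𝟙 (det M ℤ.≟ b) ≡⟨ cong (λ d → 𝟙 (d ℤ.≟ b)) M=N ⟩
    𝟙 (det N ℤ.≟ b) ≡⟨ counts i ⟩
    walks N k i i   ≡⟨ walks-cong {M = M} {N} M≋N k i i ⟨
    walks M k i i   ∎
  where
  M=N : det M ≡ det N
  M=N = det-cong M≋N

-- The order is tied to 3 by an equation because it will be `∣ α ∣`, which equals 3 only
-- propositionally.
det-counts-walks₃ : ∀ {m} {M : Matrix m} → IsOriented M → m ≡ 3 → DetCountsWalks 2 1ℤ M
det-counts-walks₃ oriented refl =
  let c , M≋c = encode oriented in detCountsWalks-resp M≋c (code₃ c)

det-counts-walks₄ : ∀ {m} {M : Matrix m} → IsOriented M → m ≡ 4 → DetCountsWalks 3 -1ℤ M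
det-counts-walks₄ oriented refl =
  let c , M≋c = encode oriented in detCountsWalks-resp M≋c (code₄ c)

-- Indicators

module _ {p} {P : Set p} (P? : Dec P) where

  𝟙-true : P → 𝟙 P? ≡ 1ℤ
  𝟙-true p rewrite dec-true P? p = refl

  𝟙-false : ¬ P → 𝟙 P? ≡ 0ℤ
  𝟙-false ¬p rewrite dec-false P? ¬p = refl

-- Allows rewriting under the factor `𝟙 P?` with an equation that depends on `P`.
𝟙-guard : ∀ {p} {P : Set p} (P? : Dec P) {a b} → (P → a ≡ b) → 𝟙 P? * a ≡ 𝟙 P? * b
𝟙-guard (yes p) a≡b = cong (1ℤ *_) (a≡b p)
𝟙-guard (no _)  a≡b = refl

module _ {p q} {P : Set p} {Q : Set q} (P? : Dec P) (Q? : Dec Q) where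

  𝟙-⇔ : P ⇔ Q → 𝟙 P? ≡ 𝟙 Q?
  𝟙-⇔ P⇔Q rewrite does-⇔ P⇔Q P? Q? = refl

  𝟙-× : 𝟙 (P? ×-dec Q?) ≡ 𝟙 P? * 𝟙 Q?
  𝟙-× with does P? | does Q?
  ... | true  | true  = refl
  ... | true  | false = refl
  ... | false | _     = refl

sum-zero : ∀ {n} {f : Fin n → ℤ} → (∀ i → f i ≡ 0ℤ) → sum f ≡ 0ℤ
sum-zero {n} f≡0 = trans (sum-cong-≗ f≡0) (sum-replicate-zero n)

sum-δ : ∀ {n} (x : Fin n) (f : Fin n → ℤ) → sum (λ z → 𝟙 (x Fin.≟ z) * f z) ≡ f x
sum-δ {suc n} zero    f = trans (cong₂ _+_ (ℤ.*-identityˡ (f zero)) (sum-zero {f = λ z → 𝟙 (zero Fin.≟ suc z) * f (suc z)} λ _ → refl)) (ℤ.+-identityʳ (f zero))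
sum-δ (suc x) f = trans (ℤ.+-identityˡ _) (trans (sum-cong-≗ λ z → cong (_* f (suc z))
  (𝟙-⇔ (suc x Fin.≟ suc z) (x Fin.≟ z) (mk⇔ (λ { refl → refl }) (cong suc)))) (sum-δ x (f ∘ suc)))

-- Sums over vectors and over subsets

Σvec : ∀ {v} k → (Vec (Fin v) k → ℤ) → ℤ
Σvec zero    f = f []
Σvec (suc k) f = sum λ p → Σvec k λ ps → f (p ∷ ps)

Σvec-cong : ∀ {v} k {f g : Vec (Fin v) k → ℤ} → f ≗ g → Σvec k f ≡ Σvec k g
Σvec-cong zero    f≗g = f≗g []
Σvec-cong (suc k) f≗g = sum-cong-≗ λ p → Σvec-cong k λ ps → f≗g (p ∷ ps)

Σvec-+ : ∀ {v} k (f g : Vec (Fin v) k → ℤ) →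
         Σvec k (λ ps → f ps + g ps) ≡ Σvec k f + Σvec k g
Σvec-+ zero    f g = refl
Σvec-+ (suc k) f g =
  trans (sum-cong-≗ λ p → Σvec-+ k (f ∘ (p ∷_)) (g ∘ (p ∷_)))
    (∑-distrib-+ (λ p → Σvec k (f ∘ (p ∷_))) (λ p → Σvec k (g ∘ (p ∷_))))

*-distribˡ-Σvec : ∀ {v} k c (f : Vec (Fin v) k → ℤ) → c * Σvec k f ≡ Σvec k (λ ps → c * f ps)
*-distribˡ-Σvec zero    c f = refl
*-distribˡ-Σvec (suc k) c f =
  trans (*-distribˡ-sum c (λ p → Σvec k (f ∘ (p ∷_)))) (sum-cong-≗ λ p → *-distribˡ-Σvec k c (f ∘ (p ∷_)))

-- Recurses in the same way as `subsets`, so that the length of a filtered list becomes a sum of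
-- indicators in `count-subsets`.
Σsub : ∀ {v} → (Subset v → ℤ) → ℤ
Σsub {zero}  f = f []
Σsub {suc v} f = Σsub (f ∘ (outside ∷_)) + Σsub (f ∘ (inside ∷_))

Σsub-cong : ∀ {v} {f g : Subset v → ℤ} → f ≗ g → Σsub f ≡ Σsub g
Σsub-cong {zero}  f≗g = f≗g []
Σsub-cong {suc v} f≗g = cong₂ _+_ (Σsub-cong (f≗g ∘ (outside ∷_))) (Σsub-cong (f≗g ∘ (inside ∷_)))

Σsub-zero : ∀ {v} {f : Subset v → ℤ} → (∀ α → f α ≡ 0ℤ) → Σsub f ≡ 0ℤ
Σsub-zero {zero}  f≡0 = f≡0 []
Σsub-zero {suc v} f≡0 = cong₂ _+_ (Σsub-zero (f≡0 ∘ (outside ∷_))) (Σsub-zero (f≡0 ∘ (inside ∷_)))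

Σsub-+ : ∀ {v} (f g : Subset v → ℤ) → Σsub (λ α → f α + g α) ≡ Σsub f + Σsub g
Σsub-+ {zero}  f g = refl
Σsub-+ {suc v} f g = trans
  (cong₂ _+_ (Σsub-+ (f ∘ (outside ∷_)) (g ∘ (outside ∷_))) (Σsub-+ (f ∘ (inside ∷_)) (g ∘ (inside ∷_))))
  (interchange (Σsub (f ∘ (outside ∷_))) (Σsub (g ∘ (outside ∷_)))
               (Σsub (f ∘ (inside ∷_)))  (Σsub (g ∘ (inside ∷_))))
  where
  interchange : ∀ a b c d → (a + b) + (c + d) ≡ (a + c) + (b + d)
  interchange = solve-∀

*-distribˡ-Σsub : ∀ {v} c (f : Subset v → ℤ) → c * Σsub f ≡ Σsub (λ α → c * f α)
*-distribˡ-Σsub {zero}  c f = refl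
*-distribˡ-Σsub {suc v} c f =
  trans
    (ℤ.*-distribˡ-+ c (Σsub (f ∘ (outside ∷_))) (Σsub (f ∘ (inside ∷_))))
    (cong₂ _+_ (*-distribˡ-Σsub c (f ∘ (outside ∷_))) (*-distribˡ-Σsub c (f ∘ (inside ∷_))))

Σsub-sum : ∀ {v n} (f : Subset v → Fin n → ℤ) →
           Σsub (λ α → sum (f α)) ≡ sum (λ p → Σsub (λ α → f α p))
Σsub-sum {zero}  f = refl
Σsub-sum {suc v} f = trans
  (cong₂ _+_ (Σsub-sum (f ∘ (outside ∷_))) (Σsub-sum (f ∘ (inside ∷_))))
  (sym (∑-distrib-+ (λ p → Σsub λ α → f (outside ∷ α) p) (λ p → Σsub λ α → f (inside ∷ α) p)))

Σsub-Σvec : ∀ {u v} k (f : Subset u → Vec (Fin v) k → ℤ) →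
            Σsub (λ α → Σvec k (f α)) ≡ Σvec k (λ ps → Σsub (λ α → f α ps))
Σsub-Σvec zero    f = refl
Σsub-Σvec (suc k) f =
  trans (Σsub-sum λ α p → Σvec k (f α ∘ (p ∷_))) (sum-cong-≗ λ p → Σsub-Σvec k (λ α → f α ∘ (p ∷_)))

length-filter-map : ∀ {a b p} {A : Set a} {B : Set b} {P : Pred B p} (P? : Decidable P) (f : A → B) xs →
                    length (filter P? (map f xs)) ≡ length (filter (P? ∘ f) xs)
length-filter-map P? f List.[] = refl
length-filter-map P? f (x List.∷ xs) with does (P? (f x))
... | true  = cong suc (length-filter-map P? f xs)
... | false = length-filter-map P? f xs

count-subsets : ∀ v {P : Pred (Subset v) 0ℓ} (P? : Decidable P) →
                + length (filter P? (subsets v)) ≡ Σsub (𝟙 ∘ P?)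
count-subsets zero P? with does (P? [])
... | true  = refl
... | false = refl
count-subsets (suc v) P? = begin
  + length (filter P? (outs List.++ ins))
    ≡⟨ cong (+_ ∘ length) (filter-++ P? outs ins) ⟩
  + length (filter P? outs List.++ filter P? ins)
    ≡⟨ cong +_ (length-++ (filter P? outs)) ⟩
  + length (filter P? outs) + + length (filter P? ins)
    ≡⟨ cong₂ (λ a b → + a + + b) (length-filter-map P? _ (subsets v)) (length-filter-map P? _ (subsets v)) ⟩
  + length (filter (P? ∘ (outside ∷_)) (subsets v)) + + length (filter (P? ∘ (inside ∷_)) (subsets v))
    ≡⟨ cong₂ _+_ (count-subsets v (P? ∘ _)) (count-subsets v (P? ∘ _)) ⟩
  Σsub (𝟙 ∘ P?) ∎
  where
  outs = map (outside ∷_) (subsets v)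
  ins  = map (inside ∷_) (subsets v)

-- Supersets

⊇∧≡⇒≡ : ∀ {v} {T α : Subset v} → T ⊆ α → ∣ α ∣ ≡ ∣ T ∣ → α ≡ T
⊇∧≡⇒≡ {T = []}          {[]}          T⊆α eq = refl
⊇∧≡⇒≡ {T = outside ∷ T} {outside ∷ α} T⊆α eq = cong (outside ∷_) (⊇∧≡⇒≡ (drop-∷-⊆ T⊆α) eq)
⊇∧≡⇒≡ {T = inside  ∷ T} {inside  ∷ α} T⊆α eq =
  cong (inside ∷_) (⊇∧≡⇒≡ (drop-∷-⊆ T⊆α) (ℕ.suc-injective eq))
⊇∧≡⇒≡ {T = inside  ∷ T} {outside ∷ α} T⊆α eq with () ← T⊆α here
⊇∧≡⇒≡ {T = outside ∷ T} {inside  ∷ α} T⊆α eq =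
  ⊥-elim (ℕ.<⇒≢ (ℕ.s≤s (p⊆q⇒∣p∣≤∣q∣ (drop-∷-⊆ T⊆α))) (sym eq))

-- Induction on `T`: an element of `T` is forced into `α`, while an element outside `T` is either
-- left out or taken, which is Pascal's rule. Writing the size as `∣ T ∣ ℕ.+ j` avoids a
-- subtraction.
count-supersets : ∀ {v} (T : Subset v) j →
  Σsub (λ α → 𝟙 (∣ α ∣ ℕ.≟ ∣ T ∣ ℕ.+ j) * 𝟙 (T ⊆? α)) ≡ + (∣ ∁ T ∣ C j)
count-supersets [] zero    = refl
count-supersets [] (suc j) = refl
count-supersets (inside ∷ T) j = begin
  Σsub (λ α → 𝟙 (∣ α ∣ ℕ.≟ suc ∣ T ∣ ℕ.+ j) * 𝟙 (inside ∷ T ⊆? outside ∷ α)) +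
  Σsub (λ α → 𝟙 (suc ∣ α ∣ ℕ.≟ suc ∣ T ∣ ℕ.+ j) * 𝟙 (inside ∷ T ⊆? inside ∷ α))
    ≡⟨ cong₂ _+_
        (Σsub-zero λ α → trans (cong (𝟙 (∣ α ∣ ℕ.≟ suc ∣ T ∣ ℕ.+ j) *_)
          (𝟙-false (inside ∷ T ⊆? outside ∷ α) λ T⊆α → zero∉outside (T⊆α here))) (ℤ.*-zeroʳ (𝟙 (∣ α ∣ ℕ.≟ suc ∣ T ∣ ℕ.+ j))))
        (Σsub-cong λ α → cong₂ _*_
          (𝟙-⇔ (suc ∣ α ∣ ℕ.≟ suc ∣ T ∣ ℕ.+ j) (∣ α ∣ ℕ.≟ ∣ T ∣ ℕ.+ j) (mk⇔ ℕ.suc-injective (cong suc)))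
          (𝟙-⇔ (inside ∷ T ⊆? inside ∷ α) (T ⊆? α) (mk⇔ drop-∷-⊆ s⊆s))) ⟩
  0ℤ + Σsub (λ α → 𝟙 (∣ α ∣ ℕ.≟ ∣ T ∣ ℕ.+ j) * 𝟙 (T ⊆? α))
    ≡⟨ trans (ℤ.+-identityˡ _) (count-supersets T j) ⟩
  + (∣ ∁ T ∣ C j) ∎
  where
  zero∉outside : ∀ {v} {α : Subset v} → zero ∉ outside ∷ α
  zero∉outside ()
count-supersets {suc v} (outside ∷ T) j = begin
  Σsub (λ α → 𝟙 (∣ α ∣ ℕ.≟ ∣ T ∣ ℕ.+ j) * 𝟙 (outside ∷ T ⊆? outside ∷ α)) +
  Σsub (λ α → 𝟙 (suc ∣ α ∣ ℕ.≟ ∣ T ∣ ℕ.+ j) * 𝟙 (outside ∷ T ⊆? inside ∷ α))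
    ≡⟨ cong₂ _+_
        (Σsub-cong λ α → cong (𝟙 (∣ α ∣ ℕ.≟ ∣ T ∣ ℕ.+ j) *_)
          (𝟙-⇔ (outside ∷ T ⊆? outside ∷ α) (T ⊆? α) (mk⇔ drop-∷-⊆ out⊆)))
        (Σsub-cong λ α → cong (𝟙 (suc ∣ α ∣ ℕ.≟ ∣ T ∣ ℕ.+ j) *_)
          (𝟙-⇔ (outside ∷ T ⊆? inside ∷ α) (T ⊆? α) (mk⇔ drop-∷-⊆ out⊆))) ⟩
  Σsub (λ α → 𝟙 (∣ α ∣ ℕ.≟ ∣ T ∣ ℕ.+ j) * 𝟙 (T ⊆? α)) +
  Σsub (λ α → 𝟙 (suc ∣ α ∣ ℕ.≟ ∣ T ∣ ℕ.+ j) * 𝟙 (T ⊆? α))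
    ≡⟨ cong₂ _+_ (count-supersets T j) (with-new j) ⟩
  + (∣ ∁ T ∣ C j) + + below j
    ≡⟨ cong +_ (pascal j) ⟩
  + (suc ∣ ∁ T ∣ C j) ∎
  where
  -- The binomial coefficient with lower index `j - 1`, read as 0 for `j = 0`.
  below : ℕ → ℕ
  below zero    = 0
  below (suc j) = ∣ ∁ T ∣ C j

  pascal : ∀ j → ∣ ∁ T ∣ C j ℕ.+ below j ≡ suc ∣ ∁ T ∣ C j
  pascal zero    = refl
  pascal (suc j) = trans (ℕ.+-comm (∣ ∁ T ∣ C suc j) _) (nCk+nC[k+1]≡[n+1]C[k+1] ∣ ∁ T ∣ j)

  with-new : ∀ j → Σsub (λ α → 𝟙 (suc ∣ α ∣ ℕ.≟ ∣ T ∣ ℕ.+ j) * 𝟙 (T ⊆? α)) ≡ + below j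
  -- A superset of `T` cannot have one element fewer than `T`, so every term vanishes.
  with-new zero = Σsub-zero {v} λ α → trans
    (𝟙-guard (suc ∣ α ∣ ℕ.≟ ∣ T ∣ ℕ.+ 0) {b = 0ℤ} λ eq → 𝟙-false (T ⊆? α) λ T⊆α →
      ℕ.<⇒≱ (ℕ.≤-reflexive (trans eq (ℕ.+-identityʳ _))) (p⊆q⇒∣p∣≤∣q∣ T⊆α))
    (ℤ.*-zeroʳ (𝟙 (suc ∣ α ∣ ℕ.≟ ∣ T ∣ ℕ.+ 0)))
  with-new (suc j) = trans
    (Σsub-cong λ α → cong (_* 𝟙 (T ⊆? α))
      (𝟙-⇔ (suc ∣ α ∣ ℕ.≟ ∣ T ∣ ℕ.+ suc j) (∣ α ∣ ℕ.≟ ∣ T ∣ ℕ.+ j)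
        (mk⇔ (λ eq → ℕ.suc-injective (trans eq (ℕ.+-suc _ j)))
             (λ eq → trans (cong suc eq) (sym (ℕ.+-suc _ j))))))
    (count-supersets T j)

-- Vertex sets of vectors

support : ∀ {v k} → Vec (Fin v) k → Subset v
support []       = ⊥
support (p ∷ ps) = ⁅ p ⁆ ∪ support ps

support⊆⇔ : ∀ {v k} (ps : Vec (Fin v) k) {α} → support ps ⊆ α ⇔ All (_∈ α) ps
support⊆⇔ ps = mk⇔ (to ps) (from ps)
  where
  to : ∀ {v k} (ps : Vec (Fin v) k) {α} → support ps ⊆ α → All (_∈ α) ps
  to []       _   = []
  to (p ∷ ps) s⊆α = s⊆α (x∈p∪q⁺ (inj₁ (x∈⁅x⁆ p))) ∷ to ps (s⊆α ∘ x∈p∪q⁺ ∘ inj₂)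

  from : ∀ {v k} (ps : Vec (Fin v) k) {α} → All (_∈ α) ps → support ps ⊆ α
  from []       []            x∈⊥ = ⊥-elim (∉⊥ x∈⊥)
  from (p ∷ ps) {α} (p∈α ∷ ps⊆α) x∈ with x∈p∪q⁻ ⁅ p ⁆ (support ps) x∈
  ... | inj₁ x∈⁅p⁆ = subst (_∈ α) (sym (x∈⁅y⁆⇒x≡y p x∈⁅p⁆)) p∈α
  ... | inj₂ x∈ps  = from ps ps⊆α x∈ps

∉support : ∀ {v k x} {ps : Vec (Fin v) k} → All (x ≢_) ps → x ∉ support ps
∉support []           x∈ = ∉⊥ x∈
∉support {ps = p ∷ ps} (x≢p ∷ x≢ps) x∈ =
  [ x≢p ∘ x∈⁅y⁆⇒x≡y p , ∉support x≢ps ]′ (x∈p∪q⁻ ⁅ p ⁆ (support ps) x∈)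

∣⁅x⁆∪T∣ : ∀ {v} {x : Fin v} {T} → x ∉ T → ∣ ⁅ x ⁆ ∪ T ∣ ≡ suc ∣ T ∣
∣⁅x⁆∪T∣ {x = zero}  {inside  ∷ T} x∉T = ⊥-elim (x∉T here)
∣⁅x⁆∪T∣ {x = zero}  {outside ∷ T} x∉T = cong (suc ∘ ∣_∣) (∪-identityˡ T)
∣⁅x⁆∪T∣ {x = suc x} {inside  ∷ T} x∉T = cong suc (∣⁅x⁆∪T∣ (x∉T ∘ there))
∣⁅x⁆∪T∣ {x = suc x} {outside ∷ T} x∉T = ∣⁅x⁆∪T∣ (x∉T ∘ there)

∣support∣ : ∀ {v k} {ps : Vec (Fin v) k} → Unique ps → ∣ support ps ∣ ≡ k
∣support∣ {v} []        = ∣⊥∣≡0 v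
∣support∣ (p≢ps ∷ uniq) = trans (∣⁅x⁆∪T∣ (∉support p≢ps)) (cong suc (∣support∣ uniq))

occurrences : ∀ {v k} → Fin v → Vec (Fin v) k → ℤ
occurrences y []       = 0ℤ
occurrences y (p ∷ ps) = 𝟙 (y Fin.≟ p) + occurrences y ps

-- Trades membership for a multiplicity, which is additive along the vector and can therefore be
-- summed one step of a walk at a time.
𝟙-∈support : ∀ {v k} y {ps : Vec (Fin v) k} → Unique ps →
             𝟙 (y ∈? support ps) ≡ occurrences y ps
𝟙-∈support {v} y []  = 𝟙-false (y ∈? ⊥) ∉⊥
𝟙-∈support y {p ∷ ps} (p≢ps ∷ uniq) with y Fin.≟ p
... | yes refl = begin
  𝟙 (y ∈? ⁅ y ⁆ ∪ support ps) ≡⟨ 𝟙-true (y ∈? ⁅ y ⁆ ∪ support ps) (x∈p∪q⁺ (inj₁ (x∈⁅x⁆ y))) ⟩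
  1ℤ + 0ℤ                     ≡⟨ cong (ℤ._+_ 1ℤ) (𝟙-false (y ∈? support ps) (∉support p≢ps)) ⟨
  1ℤ + 𝟙 (y ∈? support ps)    ≡⟨ cong (ℤ._+_ 1ℤ) (𝟙-∈support y uniq) ⟩
  1ℤ + occurrences y ps       ∎
... | no y≢p = begin
  𝟙 (y ∈? ⁅ p ⁆ ∪ support ps) ≡⟨ 𝟙-⇔ (y ∈? ⁅ p ⁆ ∪ support ps) (y ∈? support ps) (mk⇔
    (λ y∈ → [ ⊥-elim ∘ y≢p ∘ x∈⁅y⁆⇒x≡y p , (λ y∈ps → y∈ps) ]′ (x∈p∪q⁻ ⁅ p ⁆ (support ps) y∈))
    (x∈p∪q⁺ ∘ inj₂)) ⟩
  𝟙 (y ∈? support ps)         ≡⟨ 𝟙-∈support y uniq ⟩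
  occurrences y ps            ≡⟨ ℤ.+-identityˡ _ ⟨
  0ℤ + occurrences y ps       ∎

-- The `k` distinct entries already fill a `k`-subset, so `support ps` is the only `α` that
-- contributes.
Σsub-⊇support : ∀ {v k} {ps : Vec (Fin v) k} → Unique ps → (h : Subset v → ℤ) →
  Σsub (λ α → 𝟙 (∣ α ∣ ℕ.≟ k) * (𝟙 (all? (_∈? α) ps) * h α)) ≡ h (support ps)
Σsub-⊇support {v} {k} {ps} uniq h = begin
  Σsub (λ α → 𝟙 (∣ α ∣ ℕ.≟ k) * (𝟙 (all? (_∈? α) ps) * h α))
    ≡⟨ Σsub-cong only-support ⟩
  Σsub (λ α → h T * (𝟙 (∣ α ∣ ℕ.≟ ∣ T ∣ ℕ.+ 0) * 𝟙 (T ⊆? α)))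
    ≡⟨ *-distribˡ-Σsub (h T) (λ α → 𝟙 (∣ α ∣ ℕ.≟ ∣ T ∣ ℕ.+ 0) * 𝟙 (T ⊆? α)) ⟨
  h T * Σsub (λ α → 𝟙 (∣ α ∣ ℕ.≟ ∣ T ∣ ℕ.+ 0) * 𝟙 (T ⊆? α))
    -- With `j = 0` the binomial coefficient is 1: there is exactly one superset of the same size.
    ≡⟨ cong (h T *_) (count-supersets T 0) ⟩
  h T * 1ℤ
    ≡⟨ ℤ.*-identityʳ _ ⟩
  h T ∎
  where
  T = support ps
  ∣T∣+0≡k : ∣ T ∣ ℕ.+ 0 ≡ k
  ∣T∣+0≡k = trans (ℕ.+-identityʳ _) (∣support∣ uniq)

  rotate : ∀ a b c → a * (b * c) ≡ c * (a * b)
  rotate = solve-∀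

  only-support : ∀ α → 𝟙 (∣ α ∣ ℕ.≟ k) * (𝟙 (all? (_∈? α) ps) * h α) ≡
                       h T * (𝟙 (∣ α ∣ ℕ.≟ ∣ T ∣ ℕ.+ 0) * 𝟙 (T ⊆? α))
  only-support α rewrite ∣T∣+0≡k = begin
    𝟙 (∣ α ∣ ℕ.≟ k) * (𝟙 (all? (_∈? α) ps) * h α)
      ≡⟨ cong (λ t → 𝟙 (∣ α ∣ ℕ.≟ k) * (t * h α)) (sym (𝟙-⇔ (T ⊆? α) (all? (_∈? α) ps) (support⊆⇔ ps))) ⟩
    𝟙 (∣ α ∣ ℕ.≟ k) * (𝟙 (T ⊆? α) * h α)
      ≡⟨ 𝟙-guard (∣ α ∣ ℕ.≟ k) (λ ∣α∣≡k → 𝟙-guard (T ⊆? α) λ T⊆α →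
           cong h (⊇∧≡⇒≡ T⊆α (trans ∣α∣≡k (sym (∣support∣ uniq))))) ⟩
    𝟙 (∣ α ∣ ℕ.≟ k) * (𝟙 (T ⊆? α) * h T)
      ≡⟨ rotate (𝟙 (∣ α ∣ ℕ.≟ k)) (𝟙 (T ⊆? α)) (h T) ⟩
    h T * (𝟙 (∣ α ∣ ℕ.≟ k) * 𝟙 (T ⊆? α)) ∎

-- Walks inside a principal submatrix

sum-elements : ∀ {v} (α : Subset v) (g : Fin v → ℤ) →
               sum (g ∘ elements α) ≡ sum (λ p → 𝟙 (p ∈? α) * g p)
sum-elements []            g = refl
sum-elements (inside  ∷ α) g = cong₂ _+_ (sym (ℤ.*-identityˡ (g zero)))
  (trans (sum-elements α (g ∘ suc)) (sum-cong-≗ λ p → cong (_* g (suc p))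
    (𝟙-⇔ (p ∈? α) (suc p ∈? inside ∷ α) (mk⇔ there drop-there))))
sum-elements (outside ∷ α) g = trans
  (trans (sum-elements α (g ∘ suc)) (sum-cong-≗ λ p → cong (_* g (suc p))
    (𝟙-⇔ (p ∈? α) (suc p ∈? outside ∷ α) (mk⇔ there drop-there))))
  (sym (ℤ.+-identityˡ _))

position : ∀ {v} {α : Subset v} {x} → x ∈ α → ∃[ i ] elements α i ≡ x
position {α = inside ∷ α} here = zero , refl
position {α = inside  ∷ α} (there x∈α) = let i , eq = position x∈α in suc i , cong suc eq
position {α = outside ∷ α} (there x∈α) = let i , eq = position x∈α in i , cong suc eq

walk : ∀ {v k} → Matrix v → Fin v → Vec (Fin v) k → Fin v → ℤ
walk M x []       y = M x y
walk M x (p ∷ ps) y = M x p * walk M p ps y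

-- Induction on the number of intermediate vertices. At each step `sum-elements` turns a sum over
-- positions in `α` into a sum over all vertices weighted by membership.
walks-submatrix : ∀ {v} (M : Matrix v) α k i j → walks (M [ α ]) k i j ≡
  Σvec k (λ ps → 𝟙 (all? (_∈? α) ps) * walk M (elements α i) ps (elements α j))
walks-submatrix M α zero    i j = sym (ℤ.*-identityˡ _)
walks-submatrix M α (suc k) i j = begin
  sum (λ l → M x (elements α l) * walks (M [ α ]) k l j)
    ≡⟨ sum-cong-≗ (λ l → cong (M x (elements α l) *_) (walks-submatrix M α k l j)) ⟩
  sum (λ l → M x (elements α l) * Σvec k (λ ps → 𝟙 (all? (_∈? α) ps) * walk M (elements α l) ps y))
    ≡⟨ sum-elements α (λ p → M x p * Σvec k (λ ps → 𝟙 (all? (_∈? α) ps) * walk M p ps y)) ⟩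
  sum (λ p → 𝟙 (p ∈? α) * (M x p * Σvec k (λ ps → 𝟙 (all? (_∈? α) ps) * walk M p ps y)))
    ≡⟨ sum-cong-≗ (λ p → trans (cong (𝟙 (p ∈? α) *_) (*-distribˡ-Σvec k (M x p) _))
         (trans (*-distribˡ-Σvec k (𝟙 (p ∈? α)) _) (Σvec-cong k λ ps → trans
           (shuffle (𝟙 (p ∈? α)) (M x p) _ _)
           (cong (_* (M x p * walk M p ps y)) (sym (𝟙-× (p ∈? α) (all? (_∈? α) ps))))))) ⟩
  Σvec (suc k) (λ ps → 𝟙 (all? (_∈? α) ps) * walk M x ps y) ∎
  where
  x = elements α i
  y = elements α j
  shuffle : ∀ a b c d → a * (b * (c * d)) ≡ (a * c) * (b * d)
  shuffle = solve-∀

walks-Σvec : ∀ {v} (M : Matrix v) k x y → walks M k x y ≡ Σvec k (λ ps → walk M x ps y)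
walks-Σvec M zero    x y = refl
walks-Σvec M (suc k) x y = sum-cong-≗ λ p →
  trans (cong (M x p *_) (walks-Σvec M k p y)) (*-distribˡ-Σvec k (M x p) _)

-- Walks from x to z, counted with multiplicity the number of visits to y in between.
visits : ∀ {v} → Matrix v → Fin v → ℕ → Matrix v
visits M y zero    x z = 0ℤ
visits M y (suc k) x z = M x y * walks M k y z + sum (λ p → M x p * visits M y k p z)

-- Split by the first intermediate vertex `p`: the indicator of `y = p` selects the continuations
-- from `y`, and the remaining occurrences are counted recursively.
visits-Σvec : ∀ {v} (M : Matrix v) y k x z →
  Σvec k (λ ps → walk M x ps z * occurrences y ps) ≡ visits M y k x z
visits-Σvec M y zero    x z = ℤ.*-zeroʳ (M x z)
visits-Σvec M y (suc k) x z = begin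
  sum (λ p → Σvec k λ ps → M x p * walk M p ps z * (𝟙 (y Fin.≟ p) + occurrences y ps))
    ≡⟨ sum-cong-≗ (λ p → trans (Σvec-cong k λ ps → expand (M x p) _ (𝟙 (y Fin.≟ p)) _)
        (trans (Σvec-+ k _ _) (cong₂ _+_
          (trans (sym (*-distribˡ-Σvec k (𝟙 (y Fin.≟ p)) _)) (cong (𝟙 (y Fin.≟ p) *_)
            (trans (sym (*-distribˡ-Σvec k (M x p) _)) (cong (M x p *_) (sym (walks-Σvec M k p z))))))
          (trans (sym (*-distribˡ-Σvec k (M x p) _)) (cong (M x p *_) (visits-Σvec M y k p z)))))) ⟩
  sum (λ p → 𝟙 (y Fin.≟ p) * (M x p * walks M k p z) + M x p * visits M y k p z)
    ≡⟨ ∑-distrib-+ (λ p → 𝟙 (y Fin.≟ p) * (M x p * walks M k p z)) (λ p → M x p * visits M y k p z) ⟩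
  sum (λ p → 𝟙 (y Fin.≟ p) * (M x p * walks M k p z)) + sum (λ p → M x p * visits M y k p z)
    ≡⟨ cong (_+ sum (λ p → M x p * visits M y k p z)) (sum-δ y (λ p → M x p * walks M k p z)) ⟩
  visits M y (suc k) x z ∎
  where
  expand : ∀ a b c d → a * b * (c + d) ≡ c * (a * b) + a * (b * d)
  expand = solve-∀

-- From determinants to closed walks

module _ {v} (M : Matrix v) (k : ℕ) (b : ℤ)
         (local : ∀ α → ∣ α ∣ ≡ suc k → DetCountsWalks k b (M [ α ]))
         (simple : ∀ x (ps : Vec (Fin v) k) → walk M x ps x ≡ 0ℤ ⊎ Unique (x ∷ ps))
         where

  -- Double counting. For `x ∈ α` the indicator of determinant `b` is the number of closed walks at
  -- `x` inside `α`. After exchanging the sums, a walk of nonzero weight has distinct vertices by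
  -- `simple`, so it lies in just one `α` of the right size, its support. The weight `h` will be
  -- constant 1 for degrees and membership of a second vertex for pair degrees.
  Σsub-det : ∀ x (h : Subset v → ℤ) →
    Σsub (λ α → 𝟙 (∣ α ∣ ℕ.≟ suc k) * (𝟙 (x ∈? α) * (𝟙 (det (M [ α ]) ℤ.≟ b) * h α))) ≡
    Σvec k (λ ps → walk M x ps x * h (support (x ∷ ps)))
  Σsub-det x h = begin
    Σsub (λ α → 𝟙 (∣ α ∣ ℕ.≟ suc k) * (𝟙 (x ∈? α) * (𝟙 (det (M [ α ]) ℤ.≟ b) * h α)))
      ≡⟨ Σsub-cong (λ α → trans (𝟙-guard (∣ α ∣ ℕ.≟ suc k) λ ∣α∣ → 𝟙-guard (x ∈? α) λ x∈α →
           trans (cong (_* h α) (as-walks ∣α∣ x∈α)) (ℤ.*-comm _ (h α))) (pull-out α)) ⟩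
    Σsub (λ α → Σvec k λ ps → walk M x ps x * term α ps)
      ≡⟨ Σsub-Σvec k (λ α ps → walk M x ps x * term α ps) ⟩
    Σvec k (λ ps → Σsub λ α → walk M x ps x * term α ps)
      ≡⟨ Σvec-cong k (λ ps → trans (sym (*-distribˡ-Σsub (walk M x ps x) (λ α → term α ps))) (collapse ps)) ⟩
    Σvec k (λ ps → walk M x ps x * h (support (x ∷ ps))) ∎
    where
    term : Subset v → Vec (Fin v) k → ℤ
    term α ps = 𝟙 (∣ α ∣ ℕ.≟ suc k) * (𝟙 (all? (_∈? α) (x ∷ ps)) * h α)

    inner : Subset v → Vec (Fin v) k → ℤ
    inner α ps = 𝟙 (all? (_∈? α) ps) * walk M x ps x

    as-walks : ∀ {α} → ∣ α ∣ ≡ suc k → x ∈ α → 𝟙 (det (M [ α ]) ℤ.≟ b) ≡ Σvec k (inner α)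
    as-walks {α} ∣α∣ x∈α with position x∈α
    ... | i , refl = trans (DetCountsWalks.counts (local α ∣α∣) i) (walks-submatrix M α k i i)

    shuffle : ∀ s m h a w → s * (m * (h * (a * w))) ≡ w * (s * (m * a * h))
    shuffle = solve-∀

    pull-out : ∀ α → 𝟙 (∣ α ∣ ℕ.≟ suc k) * (𝟙 (x ∈? α) * (h α * Σvec k (inner α))) ≡
                     Σvec k (λ ps → walk M x ps x * term α ps)
    pull-out α = begin
      s * (m * (h α * Σvec k (inner α)))
        ≡⟨ cong (λ t → s * (m * t)) (*-distribˡ-Σvec k (h α) _) ⟩
      s * (m * Σvec k (λ ps → h α * inner α ps))
        ≡⟨ cong (s *_) (*-distribˡ-Σvec k m _) ⟩
      s * Σvec k (λ ps → m * (h α * inner α ps))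
        ≡⟨ *-distribˡ-Σvec k s _ ⟩
      Σvec k (λ ps → s * (m * (h α * inner α ps)))
        ≡⟨ Σvec-cong k (λ ps → trans (shuffle s m (h α) _ (walk M x ps x))
             (cong (λ t → walk M x ps x * (s * (t * h α))) (sym (𝟙-× (x ∈? α) (all? (_∈? α) ps))))) ⟩
      Σvec k (λ ps → walk M x ps x * term α ps) ∎
      where
      s = 𝟙 (∣ α ∣ ℕ.≟ suc k)
      m = 𝟙 (x ∈? α)

    collapse : ∀ ps → walk M x ps x * Σsub (λ α → term α ps) ≡ walk M x ps x * h (support (x ∷ ps))
    collapse ps with simple x ps
    ... | inj₁ w≡0  rewrite w≡0 = refl
    ... | inj₂ uniq = cong (walk M x ps x *_) (Σsub-⊇support uniq h)

-- Visits in short walks, and distinctness of vertices on closed ones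

module _ {v} (M : Matrix v) (y : Fin v) where

  walks-through : ∀ k x c → sum (λ p → M x p * (walks M k p y * c)) ≡ walks M (suc k) x y * c
  walks-through k x c = trans
    (sum-cong-≗ λ p → sym (ℤ.*-assoc (M x p) (walks M k p y) c))
    (sym (*-distribʳ-sum c (λ p → M x p * walks M k p y)))

  visits-1 : ∀ x z → visits M y 1 x z ≡ M x y * M y z
  visits-1 x z = trans (cong (ℤ._+_ (M x y * M y z))
    (sum-zero {f = λ p → M x p * 0ℤ} λ p → ℤ.*-zeroʳ (M x p))) (ℤ.+-identityʳ _)

  visits-2 : ∀ x z → visits M y 2 x z ≡ M x y * walks M 1 y z + walks M 1 x y * M y z
  visits-2 x z = cong (ℤ._+_ (M x y * walks M 1 y z)) (trans
    (sum-cong-≗ λ p → cong (M x p *_) (visits-1 p z))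
    (walks-through 0 x (M y z)))

  -- The three summands put `y` at the first, second and third intermediate position.
  visits-3 : ∀ x z → visits M y 3 x z ≡
    M x y * walks M 2 y z + (walks M 1 x y * walks M 1 y z + walks M 2 x y * M y z)
  visits-3 x z = cong (ℤ._+_ (M x y * walks M 2 y z)) (begin
    sum (λ p → M x p * visits M y 2 p z)
      ≡⟨ sum-cong-≗ (λ p → trans (cong (M x p *_) (visits-2 p z))
           (ℤ.*-distribˡ-+ (M x p) (M p y * walks M 1 y z) (walks M 1 p y * M y z))) ⟩
    sum (λ p → M x p * (M p y * walks M 1 y z) + M x p * (walks M 1 p y * M y z))
      ≡⟨ ∑-distrib-+ (λ p → M x p * (M p y * walks M 1 y z)) (λ p → M x p * (walks M 1 p y * M y z)) ⟩
    sum (λ p → M x p * (M p y * walks M 1 y z)) + sum (λ p → M x p * (walks M 1 p y * M y z))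
      ≡⟨ cong₂ _+_ (walks-through 0 x (walks M 1 y z)) (walks-through 1 x (M y z)) ⟩
    walks M 1 x y * walks M 1 y z + walks M 2 x y * M y z ∎)

module _ {v} {M : Matrix v} (oriented : IsOriented M) where

  -- Any two vertices of a closed walk of three steps are consecutive, so a coincidence would be a
  -- loop.
  simple₃ : ∀ x (ps : Vec (Fin v) 2) → walk M x ps x ≡ 0ℤ ⊎ Unique (x ∷ ps)
  simple₃ x (p ∷ r ∷ []) with x Fin.≟ p | p Fin.≟ r | x Fin.≟ r
  ... | yes refl | _ | _ rewrite zero-diagonal oriented x = inj₁ refl
  ... | no _ | yes refl | _ rewrite zero-diagonal oriented p = inj₁ (ℤ.*-zeroʳ (M x p))
  ... | no _ | no _ | yes refl rewrite zero-diagonal oriented x | ℤ.*-zeroʳ (M p x) = inj₁ (ℤ.*-zeroʳ (M x p))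
  ... | no x≢p | no p≢r | no x≢r = inj₂ ((x≢p ∷ x≢r ∷ []) ∷ (p≢r ∷ []) ∷ [] ∷ [])

  -- Of the six possible coincidences, four are between consecutive vertices and give loops; the two
  -- between opposite vertices, `x = r` and `p = s`, give 2-cycles.
  simple₄ : ∀ x (ps : Vec (Fin v) 3) → walk M x ps x ≡ 0ℤ ⊎ Unique (x ∷ ps)
  simple₄ x (p ∷ r ∷ s ∷ []) with x Fin.≟ p | p Fin.≟ r | r Fin.≟ s | x Fin.≟ s | x Fin.≟ r | p Fin.≟ s
  ... | yes refl | _ | _ | _ | _ | _ rewrite zero-diagonal oriented x = inj₁ refl
  ... | _ | yes refl | _ | _ | _ | _ rewrite zero-diagonal oriented p = inj₁ (ℤ.*-zeroʳ (M x p))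
  ... | _ | _ | yes refl | _ | _ | _ rewrite zero-diagonal oriented r | ℤ.*-zeroʳ (M p r) = inj₁ (ℤ.*-zeroʳ (M x p))
  ... | _ | _ | _ | yes refl | _ | _ rewrite zero-diagonal oriented x | ℤ.*-zeroʳ (M r x) | ℤ.*-zeroʳ (M p r) =
    inj₁ (ℤ.*-zeroʳ (M x p))
  ... | _ | _ | _ | _ | yes refl | _ = inj₁ (trans (sym (ℤ.*-assoc (M x p) (M p x) (M x s * M s x)))
    (cong (_* (M x s * M s x)) (no-2-cycle oriented x p)))
  ... | _ | _ | _ | _ | _ | yes refl = inj₁ (trans (cong (M x p *_)
    (trans (sym (ℤ.*-assoc (M p r) (M r p) (M p x))) (cong (_* M p x) (no-2-cycle oriented p r)))) (ℤ.*-zeroʳ (M x p)))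
  ... | no x≢p | no p≢r | no r≢s | no x≢s | no x≢r | no p≢s =
    inj₂ ((x≢p ∷ x≢r ∷ x≢s ∷ []) ∷ (p≢r ∷ p≢s ∷ []) ∷ (r≢s ∷ []) ∷ [] ∷ [])

-- Degrees and pair degrees of the determinant hypergraphs

∈-subsets : ∀ {v} (α : Subset v) → α List.∈ subsets v
∈-subsets []            = Any.here refl
∈-subsets (outside ∷ α) = ∈-++⁺ˡ (∈-map⁺ (outside ∷_) (∈-subsets α))
∈-subsets (inside  ∷ α) = ∈-++⁺ʳ (map (outside ∷_) (subsets _)) (∈-map⁺ (inside ∷_) (∈-subsets α))

inhabited : ∀ {v k} (α : Subset v) → ∣ α ∣ ≡ suc k → ∃[ x ] x ∈ α
inhabited (inside  ∷ α) _  = zero , here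
inhabited (outside ∷ α) eq = let x , x∈α = inhabited α eq in suc x , there x∈α

count-⊇support : ∀ {v l} {ps : Vec (Fin v) l} → Unique ps → ∀ j →
  Σsub (λ α → 𝟙 (∣ α ∣ ℕ.≟ l ℕ.+ j) * 𝟙 (all? (_∈? α) ps)) ≡ + ((v ℕ.∸ l) C j)
count-⊇support {v} {l} {ps} uniq j = begin
  Σsub (λ α → 𝟙 (∣ α ∣ ℕ.≟ l ℕ.+ j) * 𝟙 (all? (_∈? α) ps))
    ≡⟨ Σsub-cong (λ α → cong₂ (λ m t → 𝟙 (∣ α ∣ ℕ.≟ m ℕ.+ j) * t) (sym (∣support∣ uniq))
         (sym (𝟙-⇔ (support ps ⊆? α) (all? (_∈? α) ps) (support⊆⇔ ps)))) ⟩
  Σsub (λ α → 𝟙 (∣ α ∣ ℕ.≟ ∣ support ps ∣ ℕ.+ j) * 𝟙 (support ps ⊆? α))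
    ≡⟨ count-supersets (support ps) j ⟩
  + (∣ ∁ (support ps) ∣ C j)
    ≡⟨ cong (λ m → + (m C j)) (trans (∣∁p∣≡n∸∣p∣ (support ps)) (cong (v ℕ.∸_) (∣support∣ uniq))) ⟩
  + ((v ℕ.∸ l) C j) ∎

-- The order of the factors and the trailing `1ℤ` match `Σsub-det` with constant weight 1.
degree-Σsub : ∀ {v} (M : Matrix v) k a x → + degree (𝓗 M k a) x ≡
  Σsub (λ α → 𝟙 (∣ α ∣ ℕ.≟ k) * (𝟙 (x ∈? α) * (𝟙 (det (M [ α ]) ℤ.≟ a) * 1ℤ)))
degree-Σsub {v} M k a x = trans
  (count-subsets v λ α → ((∣ α ∣ ℕ.≟ k) ×-dec (det (M [ α ]) ℤ.≟ a)) ×-dec (x ∈? α))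
  (Σsub-cong λ α → trans (𝟙-× ((∣ α ∣ ℕ.≟ k) ×-dec (det (M [ α ]) ℤ.≟ a)) (x ∈? α))
    (trans (cong (_* 𝟙 (x ∈? α)) (𝟙-× (∣ α ∣ ℕ.≟ k) (det (M [ α ]) ℤ.≟ a)))
      (shuffle (𝟙 (∣ α ∣ ℕ.≟ k)) (𝟙 (det (M [ α ]) ℤ.≟ a)) (𝟙 (x ∈? α)))))
  where
  shuffle : ∀ s d m → s * d * m ≡ s * (m * (d * 1ℤ))
  shuffle = solve-∀

pairDegree-Σsub : ∀ {v} (M : Matrix v) k a x y → + pairDegree (𝓗 M k a) x y ≡
  Σsub (λ α → 𝟙 (∣ α ∣ ℕ.≟ k) * (𝟙 (x ∈? α) * (𝟙 (det (M [ α ]) ℤ.≟ a) * 𝟙 (y ∈? α))))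
pairDegree-Σsub {v} M k a x y = trans
  (count-subsets v λ α → ((∣ α ∣ ℕ.≟ k) ×-dec (det (M [ α ]) ℤ.≟ a)) ×-dec ((x ∈? α) ×-dec (y ∈? α)))
  (Σsub-cong λ α → trans (𝟙-× ((∣ α ∣ ℕ.≟ k) ×-dec (det (M [ α ]) ℤ.≟ a)) ((x ∈? α) ×-dec (y ∈? α)))
    (trans (cong₂ _*_ (𝟙-× (∣ α ∣ ℕ.≟ k) (det (M [ α ]) ℤ.≟ a)) (𝟙-× (x ∈? α) (y ∈? α)))
      (shuffle (𝟙 (∣ α ∣ ℕ.≟ k)) (𝟙 (det (M [ α ]) ℤ.≟ a)) (𝟙 (x ∈? α)) (𝟙 (y ∈? α)))))
  where
  shuffle : ∀ s d m t → s * d * (m * t) ≡ s * (m * (d * t))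
  shuffle = solve-∀

module Counting {v} (M : Matrix v) (l : ℕ) (b : ℤ) (b≢0 : b ≢ 0ℤ)
         (local : ∀ α → ∣ α ∣ ≡ 2 ℕ.+ l → DetCountsWalks (suc l) b (M [ α ]))
         (simple : ∀ x (ps : Vec (Fin v) (suc l)) → walk M x ps x ≡ 0ℤ ⊎ Unique (x ∷ ps))
         where

  degree-b : ∀ x → + degree (𝓗 M (2 ℕ.+ l) b) x ≡ walks M (suc l) x x
  degree-b x = begin
    + degree (𝓗 M (2 ℕ.+ l) b) x              ≡⟨ degree-Σsub M (2 ℕ.+ l) b x ⟩
    _                                         ≡⟨ Σsub-det M (suc l) b local simple x (λ _ → 1ℤ) ⟩
    Σvec (suc l) (λ ps → walk M x ps x * 1ℤ)  ≡⟨ Σvec-cong (suc l) (λ ps → ℤ.*-identityʳ (walk M x ps x)) ⟩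
    Σvec (suc l) (λ ps → walk M x ps x)       ≡⟨ walks-Σvec M (suc l) x x ⟨
    walks M (suc l) x x                       ∎

  -- The weight in `Σsub-det` is membership of `y`. On a closed walk of nonzero weight the vertices
  -- are distinct, and `y` is not the base point `x`, so membership equals the number of
  -- intermediate visits to `y`.
  pairDegree-b : ∀ x y → x ≢ y → + pairDegree (𝓗 M (2 ℕ.+ l) b) x y ≡ visits M y (suc l) x x
  pairDegree-b x y x≢y = begin
    + pairDegree (𝓗 M (2 ℕ.+ l) b) x y  ≡⟨ pairDegree-Σsub M (2 ℕ.+ l) b x y ⟩
    _ ≡⟨ Σsub-det M (suc l) b local simple x (λ α → 𝟙 (y ∈? α)) ⟩
    Σvec (suc l) (λ ps → walk M x ps x * 𝟙 (y ∈? support (x ∷ ps)))  ≡⟨ Σvec-cong (suc l) visit ⟩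
    Σvec (suc l) (λ ps → walk M x ps x * occurrences y ps)  ≡⟨ visits-Σvec M y (suc l) x x ⟩
    visits M y (suc l) x x              ∎
    where
    visit : ∀ ps → walk M x ps x * 𝟙 (y ∈? support (x ∷ ps)) ≡ walk M x ps x * occurrences y ps
    visit ps with simple x ps
    ... | inj₁ w≡0 rewrite w≡0 = refl
    ... | inj₂ uniq = cong (walk M x ps x *_) (begin
      𝟙 (y ∈? support (x ∷ ps))             ≡⟨ 𝟙-∈support y uniq ⟩
      𝟙 (y Fin.≟ x) + occurrences y ps      ≡⟨ cong (_+ occurrences y ps) (𝟙-false (y Fin.≟ x) (x≢y ∘ sym)) ⟩
      0ℤ + occurrences y ps                 ≡⟨ ℤ.+-identityˡ _ ⟩
      occurrences y ps                      ∎)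

  private
    term : ℤ → Fin v → (Subset v → ℤ) → Subset v → ℤ
    term a x h α = 𝟙 (∣ α ∣ ℕ.≟ 2 ℕ.+ l) * (𝟙 (x ∈? α) * (𝟙 (det (M [ α ]) ℤ.≟ a) * h α))

  𝟙-0+𝟙-b : ∀ {d} → d ≡ 0ℤ ⊎ d ≡ b → 𝟙 (d ℤ.≟ 0ℤ) + 𝟙 (d ℤ.≟ b) ≡ 1ℤ
  𝟙-0+𝟙-b (inj₁ refl) = cong (ℤ._+_ 1ℤ) (𝟙-false (0ℤ ℤ.≟ b) (b≢0 ∘ sym))
  𝟙-0+𝟙-b (inj₂ refl) = cong₂ _+_ (𝟙-false (b ℤ.≟ 0ℤ) b≢0) (𝟙-true (b ℤ.≟ b) refl)

  -- On subsets of the right size the determinant is 0 or `b`, and `b` is nonzero, so the two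
  -- indicators add up to 1. This reduces the value 0 to the value `b`.
  Σsub-complement : ∀ x h → Σsub (term 0ℤ x h) + Σsub (term b x h) ≡
    Σsub (λ α → 𝟙 (∣ α ∣ ℕ.≟ 2 ℕ.+ l) * (𝟙 (x ∈? α) * h α))
  Σsub-complement x h = trans (sym (Σsub-+ (term 0ℤ x h) (term b x h))) (Σsub-cong λ α →
    trans (factor (𝟙 (∣ α ∣ ℕ.≟ 2 ℕ.+ l)) (𝟙 (x ∈? α)) (𝟙 (det (M [ α ]) ℤ.≟ 0ℤ)) (𝟙 (det (M [ α ]) ℤ.≟ b)) (h α))
      (𝟙-guard (∣ α ∣ ℕ.≟ 2 ℕ.+ l) λ ∣α∣ → trans
        (cong (λ t → 𝟙 (x ∈? α) * (t * h α)) (𝟙-0+𝟙-b (DetCountsWalks.det∈ (local α ∣α∣))))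
        (cong (𝟙 (x ∈? α) *_) (ℤ.*-identityˡ (h α)))))
    where
    factor : ∀ s m d e h → s * (m * (d * h)) + s * (m * (e * h)) ≡ s * (m * ((d + e) * h))
    factor = solve-∀

  degree-0 : ∀ x → + degree (𝓗 M (2 ℕ.+ l) 0ℤ) x + walks M (suc l) x x ≡ + ((v ℕ.∸ 1) C suc l)
  degree-0 x = begin
    + degree (𝓗 M (2 ℕ.+ l) 0ℤ) x + walks M (suc l) x x
      ≡⟨ cong₂ _+_ (degree-Σsub M (2 ℕ.+ l) 0ℤ x) (trans (sym (degree-b x)) (degree-Σsub M (2 ℕ.+ l) b x)) ⟩
    Σsub (term 0ℤ x (λ _ → 1ℤ)) + Σsub (term b x (λ _ → 1ℤ))
      ≡⟨ Σsub-complement x (λ _ → 1ℤ) ⟩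
    Σsub (λ α → 𝟙 (∣ α ∣ ℕ.≟ 2 ℕ.+ l) * (𝟙 (x ∈? α) * 1ℤ))
      -- The factor `1ℤ` is the indicator of `All` on the empty vector.
      ≡⟨ Σsub-cong (λ α → cong (𝟙 (∣ α ∣ ℕ.≟ 2 ℕ.+ l) *_) (sym (𝟙-× (x ∈? α) (all? (_∈? α) [])))) ⟩
    Σsub (λ α → 𝟙 (∣ α ∣ ℕ.≟ 1 ℕ.+ suc l) * 𝟙 (all? (_∈? α) (x ∷ [])))
      ≡⟨ count-⊇support {ps = x ∷ []} ([] ∷ []) (suc l) ⟩
    + ((v ℕ.∸ 1) C suc l) ∎

  pairDegree-0 : ∀ x y → x ≢ y →
    + pairDegree (𝓗 M (2 ℕ.+ l) 0ℤ) x y + visits M y (suc l) x x ≡ + ((v ℕ.∸ 2) C l)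
  pairDegree-0 x y x≢y = begin
    + pairDegree (𝓗 M (2 ℕ.+ l) 0ℤ) x y + visits M y (suc l) x x
      ≡⟨ cong₂ _+_ (pairDegree-Σsub M (2 ℕ.+ l) 0ℤ x y)
           (trans (sym (pairDegree-b x y x≢y)) (pairDegree-Σsub M (2 ℕ.+ l) b x y)) ⟩
    Σsub (term 0ℤ x (λ α → 𝟙 (y ∈? α))) + Σsub (term b x (λ α → 𝟙 (y ∈? α)))
      ≡⟨ Σsub-complement x (λ α → 𝟙 (y ∈? α)) ⟩
    Σsub (λ α → 𝟙 (∣ α ∣ ℕ.≟ 2 ℕ.+ l) * (𝟙 (x ∈? α) * 𝟙 (y ∈? α)))
      ≡⟨ Σsub-cong (λ α → cong (𝟙 (∣ α ∣ ℕ.≟ 2 ℕ.+ l) *_) (sym (trans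
           (𝟙-× (x ∈? α) (all? (_∈? α) (y ∷ [])))
           (cong (𝟙 (x ∈? α) *_) (trans (𝟙-× (y ∈? α) (all? (_∈? α) [])) (ℤ.*-identityʳ (𝟙 (y ∈? α)))))))) ⟩
    Σsub (λ α → 𝟙 (∣ α ∣ ℕ.≟ 2 ℕ.+ l) * 𝟙 (all? (_∈? α) (x ∷ y ∷ [])))
      ≡⟨ count-⊇support ((x≢y ∷ []) ∷ [] ∷ []) l ⟩
    + ((v ℕ.∸ 2) C l) ∎

-- The powers of A

sum-const : ∀ n c → sum {n} (λ _ → c) ≡ + n * c
sum-const zero    c = refl
sum-const (suc n) c = trans (cong (ℤ._+_ c) (sum-const n c)) (sym (ℤ.suc-* (+ n) c))

sum-- : ∀ {n} (f g : Fin n → ℤ) → sum (λ i → f i - g i) ≡ sum f - sum g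
sum-- {n} f g = begin
  sum (λ i → f i - g i)           ≡⟨ sum-cong-≗ (λ i → cong (ℤ._+_ (f i)) (sym (ℤ.-1*i≡-i (g i)))) ⟩
  sum (λ i → f i + -1ℤ * g i)     ≡⟨ ∑-distrib-+ f (λ i → -1ℤ * g i) ⟩
  sum f + sum (λ i → -1ℤ * g i)   ≡⟨ cong (ℤ._+_ (sum f)) (*-distribˡ-sum -1ℤ g) ⟨
  sum f + -1ℤ * sum g             ≡⟨ cong (ℤ._+_ (sum f)) (ℤ.-1*i≡-i (sum g)) ⟩
  sum f - sum g                   ∎

sum-↑ : ∀ m {n} (f : Fin (m ℕ.+ n) → ℤ) → sum f ≡ sum (λ i → f (i ↑ˡ n)) + sum (λ j → f (m ↑ʳ j))
sum-↑ zero    f = sym (ℤ.+-identityˡ (sum f))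
sum-↑ (suc m) f = trans (cong (ℤ._+_ (f zero)) (sum-↑ m (f ∘ suc))) (sym (ℤ.+-assoc (f zero) _ _))

sum-combine : ∀ m {n} (f : Fin (m ℕ.* n) → ℤ) → sum f ≡ sum {m} (λ i → sum λ r → f (combine i r))
sum-combine zero        f = refl
sum-combine (suc m) {n} f =
  trans (sum-↑ n f) (cong (ℤ._+_ (sum (λ r → f (r ↑ˡ (m ℕ.* n))))) (sum-combine m (f ∘ (n ↑ʳ_))))

I≡𝟙 : ∀ {m} (x y : Fin m) → I x y ≡ 𝟙 (x Fin.≟ y)
I≡𝟙 x y with x Fin.≟ y
... | yes _ = refl
... | no  _ = refl

module SkewBush {n : ℕ} {H : Matrix (n ℕ.* n)} (skewBush : IsSkewBush n H) where
  open IsSkewBush skewBush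
  open IsHadamard isHadamard

  N : ℤ
  N = + n

  V : Set
  V = Fin (n ℕ.* n)

  q : V → Fin n
  q = quotient {n} n

  A : Matrix (n ℕ.* n)
  A = [J- H ]/2

  -- `E (q x) (q y)` is the entry of I ⊗ J at `x` and `y`.
  E : Fin n → Fin n → ℤ
  E i j = 𝟙 (i Fin.≟ j)

  coordinates : ∀ x → combine (q x) (remainder {n} n x) ≡ x
  coordinates = Fin.combine-remQuot {n} n

  q-combine : ∀ i r → q (combine i r) ≡ i
  q-combine i r = cong proj₁ (Fin.remQuot-combine i r)

  H-same : ∀ x y → q x ≡ q y → H x y ≡ 1ℤ
  H-same x y qx≡qy = begin
    H x y ≡⟨ cong₂ H (coordinates x) (coordinates y) ⟨
    H (combine (q x) (remainder {n} n x)) (combine (q y) (remainder {n} n y))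
          ≡⟨ cong (λ i → H (combine i (remainder {n} n x)) (combine (q y) (remainder {n} n y))) qx≡qy ⟩
    H (combine (q y) (remainder {n} n x)) (combine (q y) (remainder {n} n y))
          ≡⟨ diagonal (q y) (remainder {n} n x) (remainder {n} n y) ⟩
    1ℤ    ∎

  H-skew : ∀ x y → q x ≢ q y → H x y ≡ - H y x
  H-skew x y qx≢qy = begin
    H x y ≡⟨ cong₂ H (coordinates x) (coordinates y) ⟨
    H (combine (q x) (remainder {n} n x)) (combine (q y) (remainder {n} n y))
          ≡⟨ skew (q x) (q y) qx≢qy (remainder {n} n y) (remainder {n} n x) ⟩
    - H (combine (q y) (remainder {n} n y)) (combine (q x) (remainder {n} n x))
          ≡⟨ cong -_ (cong₂ H (coordinates y) (coordinates x)) ⟩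
    - H y x ∎

  -- In matrix form, H + Hᵀ = 2(I ⊗ J): both entries are 1 inside a block, and they are opposite
  -- otherwise.
  H-transpose : ∀ x y → H x y ≡ + 2 * E (q y) (q x) - H y x
  H-transpose x y with q y Fin.≟ q x
  ... | yes eq rewrite H-same x y (sym eq) | H-same y x eq = refl
  ... | no neq = trans (H-skew x y (neq ∘ sym)) (sym (ℤ.+-identityˡ (- H y x)))

  H-row-block : ∀ x j → sum (λ r → H x (combine j r)) ≡ N * E (q x) j
  H-row-block x j with q x Fin.≟ j
  ... | yes refl = trans (sum-cong-≗ λ r → H-same x _ (sym (q-combine (q x) r))) (sum-const n 1ℤ)
  ... | no neq = begin
    sum (λ r → H x (combine j r))
      ≡⟨ sum-cong-≗ (λ r → trans (cong (λ z → H z (combine j r)) (sym (coordinates x)))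
                                 (sym (ℤ.*-identityʳ _))) ⟩
    sum (λ r → H (combine (q x) (remainder {n} n x)) (combine j r) * 1ℤ)
      -- All columns of the product with `J` hold the same row sum; the column index is an arbitrary
      -- choice.
      ≡⟨ rowSums (q x) j neq (remainder {n} n x) (remainder {n} n x) ⟩
    0ℤ ≡⟨ ℤ.*-zeroʳ N ⟨
    N * 0ℤ ∎

  sum-blocks : (g : Fin n → ℤ) → sum (λ z → g (q z)) ≡ N * sum g
  sum-blocks g = begin
    sum (λ z → g (q z))
      ≡⟨ sum-combine n {n} (g ∘ q) ⟩
    sum {n} (λ i → sum {n} λ r → g (q (combine i r)))
      ≡⟨ sum-cong-≗ (λ i → trans (sum-cong-≗ λ r → cong g (q-combine i r)) (sum-const n (g i))) ⟩
    sum (λ i → N * g i)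
      ≡⟨ *-distribˡ-sum N g ⟨
    N * sum g ∎

  -- A function constant on blocks is mapped by H to `n` times itself, because the row of `x` sums
  -- to `n` on the block of `x` and to 0 on every other block.
  H-row : ∀ x (g : Fin n → ℤ) → sum (λ z → H x z * g (q z)) ≡ N * g (q x)
  H-row x g = begin
    sum (λ z → H x z * g (q z))
      ≡⟨ sum-combine n {n} (λ z → H x z * g (q z)) ⟩
    sum {n} (λ i → sum {n} λ r → H x (combine i r) * g (q (combine i r)))
      ≡⟨ sum-cong-≗ (λ i → trans (sum-cong-≗ λ r →
           trans (cong (λ j → H x (combine i r) * g j) (q-combine i r)) (ℤ.*-comm _ (g i)))
           (trans (sym (*-distribˡ-sum (g i) (λ r → H x (combine i r))))
             (trans (cong (g i *_) (H-row-block x i)) (shuffle (g i) N (E (q x) i))))) ⟩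
    sum (λ i → N * (E (q x) i * g i))
      ≡⟨ *-distribˡ-sum N (λ i → E (q x) i * g i) ⟨
    N * sum (λ i → E (q x) i * g i)
      ≡⟨ cong (N *_) (sum-δ (q x) g) ⟩
    N * g (q x) ∎
    where
    shuffle : ∀ a b c → a * (b * c) ≡ b * (c * a)
    shuffle = solve-∀

  sum-E : ∀ i → sum (λ z → E i (q z)) ≡ N
  sum-E i = begin
    sum (λ z → E i (q z))      ≡⟨ sum-blocks (E i) ⟩
    N * sum (E i)              ≡⟨ cong (N *_) (sum-cong-≗ λ j → sym (ℤ.*-identityʳ (E i j))) ⟩
    N * sum (λ j → E i j * 1ℤ) ≡⟨ cong (N *_) (sum-δ i (λ _ → 1ℤ)) ⟩
    N * 1ℤ                     ≡⟨ ℤ.*-identityʳ N ⟩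
    N                          ∎

  -- Clears the division in the definition of `A`. The powers of `A` are likewise computed as the
  -- integral multiples 4A² and 8A³.
  2A : ∀ x y → + 2 * A x y ≡ 1ℤ - H x y
  2A x y with ±1-entries x y
  ... | inj₁ H≡1  rewrite H≡1  = refl
  ... | inj₂ H≡-1 rewrite H≡-1 = refl

  -- An arc is an entry -1 of `H`. Diagonal blocks contain none, and elsewhere skewness makes the
  -- reverse entry 1.
  A-oriented : IsOriented A
  A-oriented = record { entries = entries ; one-way = one-way }
    where
    entries : ∀ x y → A x y ≡ 0ℤ ⊎ A x y ≡ 1ℤ
    entries x y with ±1-entries x y
    ... | inj₁ H≡1  rewrite H≡1  = inj₁ refl
    ... | inj₂ H≡-1 rewrite H≡-1 = inj₂ refl

    one-way : ∀ x y → A x y ≡ 1ℤ → A y x ≡ 0ℤ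
    one-way x y Axy≡1 with q x Fin.≟ q y
    ... | yes eq rewrite H-same y x (sym eq) = refl
    ... | no neq with ±1-entries x y
    ...   | inj₁ H≡1 rewrite H≡1 with () ← Axy≡1
    ...   | inj₂ H≡-1 rewrite H-skew y x (neq ∘ sym) | H≡-1 = refl

  A+Aᵀ : ∀ x y → A x y + A y x ≡ 1ℤ - E (q x) (q y)
  A+Aᵀ x y = ℤ.*-cancelˡ-≡ (+ 2) _ _ (begin
    + 2 * (A x y + A y x)         ≡⟨ ℤ.*-distribˡ-+ (+ 2) (A x y) (A y x) ⟩
    + 2 * A x y + + 2 * A y x     ≡⟨ cong₂ _+_ (2A x y) (2A y x) ⟩
    (1ℤ - H x y) + (1ℤ - H y x)   ≡⟨ cong (λ h → (1ℤ - H x y) + (1ℤ - h)) (H-transpose y x) ⟩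
    (1ℤ - H x y) + (1ℤ - (+ 2 * E (q x) (q y) - H x y)) ≡⟨ simplify (H x y) (E (q x) (q y)) ⟩
    + 2 * (1ℤ - E (q x) (q y))    ∎)
    where
    simplify : ∀ h e → (1ℤ - h) + (1ℤ - (+ 2 * e - h)) ≡ + 2 * (1ℤ - e)
    simplify = solve-∀

  E-refl : ∀ i → E i i ≡ 1ℤ
  E-refl i = 𝟙-true (i Fin.≟ i) refl

  E-sym : ∀ i j → E i j ≡ E j i
  E-sym i j = 𝟙-⇔ (i Fin.≟ j) (j Fin.≟ i) (mk⇔ sym sym)

  -- From 2A = J - H: the part J gives the total of the function, and H is evaluated by `H-row`.
  A-row : ∀ x (g : Fin n → ℤ) → + 2 * sum (λ z → A x z * g (q z)) ≡ sum (λ z → g (q z)) - N * g (q x)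
  A-row x g = begin
    + 2 * sum (λ z → A x z * g (q z))
      ≡⟨ *-distribˡ-sum (+ 2) (λ z → A x z * g (q z)) ⟩
    sum (λ z → + 2 * (A x z * g (q z)))
      ≡⟨ sum-cong-≗ (λ z → trans (sym (ℤ.*-assoc (+ 2) (A x z) (g (q z))))
           (trans (cong (_* g (q z)) (2A x z)) (expand (H x z) (g (q z))))) ⟩
    sum (λ z → g (q z) - H x z * g (q z))
      ≡⟨ sum-- (λ z → g (q z)) (λ z → H x z * g (q z)) ⟩
    sum (λ z → g (q z)) - sum (λ z → H x z * g (q z))
      ≡⟨ cong (ℤ._-_ (sum (λ z → g (q z)))) (H-row x g) ⟩
    sum (λ z → g (q z)) - N * g (q x) ∎
    where
    expand : ∀ h g → (1ℤ - h) * g ≡ g - h * g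
    expand = solve-∀

  sum-1 : sum {n ℕ.* n} (λ _ → 1ℤ) ≡ N * N
  sum-1 = trans (sum-const (n ℕ.* n) 1ℤ) (trans (ℤ.*-identityʳ _) (ℤ.pos-* n n))

  -- With `e` and `d` the entries of I ⊗ J and I, this is the entry of (n² - 2n)J + 2n(I ⊗ J) - n²I.
  A²-term : ℤ → ℤ → ℤ
  A²-term e d = N * N - + 2 * N + + 2 * N * e - N * N * d

  -- Expand (J - H)(J - H) after writing the second H as 2(I ⊗ J) - Hᵀ. The quadratic term becomes H
  -- Hᵀ = n²I, and all others are sums of H against functions constant on blocks.
  4A² : ∀ x y → + 4 * walks A 1 x y ≡ A²-term (E (q y) (q x)) (𝟙 (x Fin.≟ y))
  4A² x y = begin
    + 4 * sum (λ z → A x z * A z y)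
      ≡⟨ *-distribˡ-sum (+ 4) (λ z → A x z * A z y) ⟩
    sum (λ z → + 4 * (A x z * A z y))
      ≡⟨ sum-cong-≗ (λ z → trans (split (A x z) (A z y))
           (trans (cong₂ _*_ (2A x z) (trans (2A z y) (cong (λ h → 1ℤ - h) (H-transpose z y))))
             (expand (H x z) (H y z) (E (q y) (q z))))) ⟩
    sum (λ z → (P z + H y z * 1ℤ + H x z * g (q z)) - H x z * H y z)
      ≡⟨ trans (sum-- (λ z → P z + H y z * 1ℤ + H x z * g (q z)) (λ z → H x z * H y z))
           (cong (_- sum (λ z → H x z * H y z))
             (trans (∑-distrib-+ (λ z → P z + H y z * 1ℤ) (λ z → H x z * g (q z)))
               (cong (_+ sum (λ z → H x z * g (q z))) (∑-distrib-+ P (λ z → H y z * 1ℤ))))) ⟩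
    sum P + sum (λ z → H y z * 1ℤ) + sum (λ z → H x z * g (q z)) - sum (λ z → H x z * H y z)
      ≡⟨ cong₂ _-_ (cong₂ _+_ (cong₂ _+_ sum-P (H-row y λ _ → 1ℤ)) (H-row x g))
           (trans (HHᵀ≋mI x y) (cong₂ _*_ (ℤ.pos-* n n) (I≡𝟙 x y))) ⟩
    (N * N - + 2 * N) + N * 1ℤ + N * (+ 2 * E (q y) (q x) - 1ℤ) - N * N * 𝟙 (x Fin.≟ y)
      ≡⟨ collect N (E (q y) (q x)) (𝟙 (x Fin.≟ y)) ⟩
    A²-term (E (q y) (q x)) (𝟙 (x Fin.≟ y)) ∎
    where
    P : V → ℤ
    P z = 1ℤ - + 2 * E (q y) (q z)

    g : Fin n → ℤ
    g j = + 2 * E (q y) j - 1ℤ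

    split : ∀ a b → + 4 * (a * b) ≡ (+ 2 * a) * (+ 2 * b)
    split = solve-∀

    expand : ∀ h k e → (1ℤ - h) * (1ℤ - (+ 2 * e - k)) ≡
             ((1ℤ - + 2 * e) + k * 1ℤ + h * (+ 2 * e - 1ℤ)) - h * k
    expand = solve-∀

    sum-P : sum P ≡ N * N - + 2 * N
    sum-P = trans (sum-- (λ _ → 1ℤ) (λ z → + 2 * E (q y) (q z)))
      (cong₂ _-_ sum-1 (trans (sym (*-distribˡ-sum (+ 2) (λ z → E (q y) (q z)))) (cong (+ 2 *_) (sum-E (q y)))))

    collect : ∀ m e d → (m * m - + 2 * m) + m * 1ℤ + m * (+ 2 * e - 1ℤ) - m * m * d ≡
              m * m - + 2 * m + + 2 * m * e - m * m * d
    collect = solve-∀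

  -- With `e` and `a` the entries of I ⊗ J and A, this is the entry of ((n² - 2n)(n² - n) + 2n²)J -
  -- 2n²(I ⊗ J) - 2n²A.
  A³-term : ℤ → ℤ → ℤ
  A³-term e a = (N * N - + 2 * N) * (N * N - N) + + 2 * N * (N - N * e) - + 2 * (N * N) * a

  -- Multiply 2A by 4A². The part -n²I of 4A² returns -2n²A, and the rest depends only on the block
  -- of `z`, so `A-row` applies.
  8A³ : ∀ x y → + 8 * walks A 2 x y ≡ A³-term (E (q y) (q x)) (A x y)
  8A³ x y = begin
    + 8 * sum (λ z → A x z * walks A 1 z y)
      ≡⟨ *-distribˡ-sum (+ 8) (λ z → A x z * walks A 1 z y) ⟩
    sum (λ z → + 8 * (A x z * walks A 1 z y))
      ≡⟨ sum-cong-≗ (λ z → trans (split (A x z) (walks A 1 z y)) (trans (cong (+ 2 * A x z *_)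
           (trans (4A² z y) (cong (λ d → A²-term (E (q y) (q z)) d)
             (𝟙-⇔ (z Fin.≟ y) (y Fin.≟ z) (mk⇔ sym sym)))))
           (expand N (A x z) (E (q y) (q z)) (𝟙 (y Fin.≟ z))))) ⟩
    sum (λ z → + 2 * (A x z * g (q z)) - + 2 * (N * N) * (𝟙 (y Fin.≟ z) * A x z))
      ≡⟨ sum-- (λ z → + 2 * (A x z * g (q z))) (λ z → + 2 * (N * N) * (𝟙 (y Fin.≟ z) * A x z)) ⟩
    sum (λ z → + 2 * (A x z * g (q z))) - sum (λ z → + 2 * (N * N) * (𝟙 (y Fin.≟ z) * A x z))
      ≡⟨ cong₂ _-_ (trans (sym (*-distribˡ-sum (+ 2) (λ z → A x z * g (q z)))) (A-row x g))
           (trans (sym (*-distribˡ-sum (+ 2 * (N * N)) (λ z → 𝟙 (y Fin.≟ z) * A x z)))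
             (cong (+ 2 * (N * N) *_) (sum-δ y (A x)))) ⟩
    (sum (λ z → g (q z)) - N * g (q x)) - + 2 * (N * N) * A x y
      ≡⟨ cong (λ t → (t - N * g (q x)) - + 2 * (N * N) * A x y) sum-g ⟩
    (((N * N) * (N * N - + 2 * N) + + 2 * N * N) - N * g (q x)) - + 2 * (N * N) * A x y
      ≡⟨ collect N (E (q y) (q x)) (A x y) ⟩
    A³-term (E (q y) (q x)) (A x y) ∎
    where
    g : Fin n → ℤ
    g j = (N * N - + 2 * N) + + 2 * N * E (q y) j

    split : ∀ a b → + 8 * (a * b) ≡ (+ 2 * a) * (+ 4 * b)
    split = solve-∀

    expand : ∀ m a e d → (+ 2 * a) * (m * m - + 2 * m + + 2 * m * e - m * m * d) ≡
             + 2 * (a * ((m * m - + 2 * m) + + 2 * m * e)) - + 2 * (m * m) * (d * a)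
    expand = solve-∀

    sum-g : sum (λ z → g (q z)) ≡ (N * N) * (N * N - + 2 * N) + + 2 * N * N
    sum-g = trans (∑-distrib-+ {n ℕ.* n} (λ _ → N * N - + 2 * N) (λ z → + 2 * N * E (q y) (q z)))
      (cong₂ _+_ (trans (sum-const (n ℕ.* n) (N * N - + 2 * N)) (cong (_* (N * N - + 2 * N)) (ℤ.pos-* n n)))
        (trans (sym (*-distribˡ-sum (+ 2 * N) (λ z → E (q y) (q z)))) (cong (+ 2 * N *_) (sum-E (q y)))))

    collect : ∀ m e a →
      (((m * m) * (m * m - + 2 * m) + + 2 * m * m) - m * ((m * m - + 2 * m) + + 2 * m * e)) - + 2 * (m * m) * a ≡
      (m * m - + 2 * m) * (m * m - m) + + 2 * m * (m - m * e) - + 2 * (m * m) * a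
    collect = solve-∀

  closed-3-walks : ∀ x → + 8 * walks A 2 x x ≡ A³-term 1ℤ 0ℤ
  closed-3-walks x = trans (8A³ x x) (cong₂ A³-term (E-refl (q x)) (zero-diagonal A-oriented x))

  closed-4-walks : ∀ x → + 16 * walks A 3 x x ≡
    (N * N - N) * ((N * N - + 2 * N) * (N * N - N) + + 2 * (N * N))
  closed-4-walks x = begin
    + 16 * sum (λ z → A x z * walks A 2 z x)
      ≡⟨ *-distribˡ-sum (+ 16) (λ z → A x z * walks A 2 z x) ⟩
    sum (λ z → + 16 * (A x z * walks A 2 z x))
      ≡⟨ sum-cong-≗ (λ z → trans (split (A x z) (walks A 2 z x)) (trans (cong (+ 2 * A x z *_) (8A³ z x))
           (trans (expand N (A x z) (A z x) (E (q x) (q z)))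
             -- Only the coefficient `c` of J in 8A³ survives: the term in A vanishes for want of
             -- 2-cycles, and the term in I ⊗ J because no arc stays inside a block.
             (cong₂ (λ s t → + 2 * (A x z * c) - + 4 * (N * N) * (s + t))
               (no-2-cycle A-oriented x z) (absent z))))) ⟩
    sum (λ z → + 2 * (A x z * c) - + 4 * (N * N) * (0ℤ + 0ℤ))
      ≡⟨ sum-cong-≗ (λ z → drop (+ 2 * (A x z * c)) (N * N)) ⟩
    sum (λ z → + 2 * (A x z * c))
      ≡⟨ trans (sym (*-distribˡ-sum (+ 2) (λ z → A x z * c))) (A-row x (λ _ → c)) ⟩
    sum {n ℕ.* n} (λ _ → c) - N * c
      ≡⟨ cong (_- N * c) (trans (sum-const (n ℕ.* n) c) (cong (_* c) (ℤ.pos-* n n))) ⟩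
    N * N * c - N * c
      ≡⟨ collect N c ⟩
    (N * N - N) * c ∎
    where
    c : ℤ
    c = (N * N - + 2 * N) * (N * N - N) + + 2 * (N * N)

    split : ∀ a b → + 16 * (a * b) ≡ (+ 2 * a) * (+ 8 * b)
    split = solve-∀

    expand : ∀ m a b e →
      (+ 2 * a) * ((m * m - + 2 * m) * (m * m - m) + + 2 * m * (m - m * e) - + 2 * (m * m) * b) ≡
      + 2 * (a * ((m * m - + 2 * m) * (m * m - m) + + 2 * (m * m))) - + 4 * (m * m) * (a * b + a * e)
    expand = solve-∀

    absent : ∀ z → A x z * E (q x) (q z) ≡ 0ℤ
    absent z with q x Fin.≟ q z
    ... | yes eq rewrite H-same x z eq = refl
    ... | no  _  = ℤ.*-zeroʳ (A x z)

    drop : ∀ a m → a - + 4 * m * (0ℤ + 0ℤ) ≡ a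
    drop = solve-∀

    collect : ∀ m c → m * m * c - m * c ≡ (m * m - m) * c
    collect = solve-∀

  -- Closed walks through two vertices

  4A²-off-diagonal : ∀ x y → x ≢ y →
    + 4 * walks A 1 x y ≡ N * N - + 2 * N + + 2 * N * E (q x) (q y)
  4A²-off-diagonal x y x≢y = begin
    + 4 * walks A 1 x y
      ≡⟨ 4A² x y ⟩
    A²-term (E (q y) (q x)) (𝟙 (x Fin.≟ y))
      ≡⟨ cong₂ A²-term (E-sym (q y) (q x)) (𝟙-false (x Fin.≟ y) x≢y) ⟩
    A²-term (E (q x) (q y)) 0ℤ
      ≡⟨ drop N (E (q x) (q y)) ⟩
    N * N - + 2 * N + + 2 * N * E (q x) (q y) ∎
    where
    drop : ∀ m e → m * m - + 2 * m + + 2 * m * e - m * m * 0ℤ ≡ m * m - + 2 * m + + 2 * m * e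
    drop = solve-∀

  -- Off the diagonal A² is symmetric, so the two positions of `y` combine into the factor A + Aᵀ.
  4visits-2 : ∀ x y → x ≢ y → + 4 * visits A y 2 x x ≡
    (1ℤ - E (q x) (q y)) * (N * N - + 2 * N + + 2 * N * E (q x) (q y))
  4visits-2 x y x≢y = begin
    + 4 * visits A y 2 x x
      ≡⟨ cong (+ 4 *_) (visits-2 A y x x) ⟩
    + 4 * (A x y * walks A 1 y x + walks A 1 x y * A y x)
      ≡⟨ distribute (A x y) (A y x) (walks A 1 y x) (walks A 1 x y) ⟩
    A x y * (+ 4 * walks A 1 y x) + A y x * (+ 4 * walks A 1 x y)
      ≡⟨ cong₂ (λ s t → A x y * s + A y x * t)
           (trans (4A²-off-diagonal y x (x≢y ∘ sym)) (cong (λ e → N * N - + 2 * N + + 2 * N * e) (E-sym (q y) (q x))))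
           (4A²-off-diagonal x y x≢y) ⟩
    A x y * p + A y x * p
      ≡⟨ ℤ.*-distribʳ-+ p (A x y) (A y x) ⟨
    (A x y + A y x) * p
      ≡⟨ cong (_* p) (A+Aᵀ x y) ⟩
    (1ℤ - E (q x) (q y)) * p ∎
    where
    p : ℤ
    p = N * N - + 2 * N + + 2 * N * E (q x) (q y)

    distribute : ∀ a b s t → + 4 * (a * s + t * b) ≡ a * (+ 4 * s) + b * (+ 4 * t)
    distribute = solve-∀

  -- Up to a multiple of A, A³ is symmetric. That multiple enters only through the product of
  -- `A x y` and `A y x`, which is 0, so the outer positions of `y` again combine into A + Aᵀ. The
  -- middle position gives the square of the A² entry.
  16visits-3 : ∀ x y → x ≢ y → + 16 * visits A y 3 x x ≡
    + 2 * ((1ℤ - E (q x) (q y)) * ((N * N - + 2 * N) * (N * N - N) + + 2 * N * (N - N * E (q x) (q y)))) +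
    (N * N - + 2 * N + + 2 * N * E (q x) (q y)) * (N * N - + 2 * N + + 2 * N * E (q x) (q y))
  16visits-3 x y x≢y = begin
    + 16 * visits A y 3 x x
      ≡⟨ cong (+ 16 *_) (visits-3 A y x x) ⟩
    + 16 * (A x y * walks A 2 y x + (walks A 1 x y * walks A 1 y x + walks A 2 x y * A y x))
      ≡⟨ distribute (A x y) (A y x) (walks A 2 y x) (walks A 2 x y) (walks A 1 x y) (walks A 1 y x) ⟩
    + 2 * (A x y * (+ 8 * walks A 2 y x) + A y x * (+ 8 * walks A 2 x y)) + (+ 4 * walks A 1 x y) * (+ 4 * walks A 1 y x)
      ≡⟨ cong₂ (λ s t → + 2 * s + t)
           (cong₂ (λ s t → A x y * s + A y x * t) (8A³ y x)
             (trans (8A³ x y) (cong (λ e → A³-term e (A x y)) (E-sym (q y) (q x)))))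
           (cong₂ _*_ (4A²-off-diagonal x y x≢y)
             (trans (4A²-off-diagonal y x (x≢y ∘ sym)) (cong (λ e → N * N - + 2 * N + + 2 * N * e) (E-sym (q y) (q x))))) ⟩
    + 2 * (A x y * (c - + 2 * (N * N) * A y x) + A y x * (c - + 2 * (N * N) * A x y)) + p * p
      ≡⟨ cong (λ t → + 2 * t + p * p) (collect N (A x y) (A y x) c) ⟩
    + 2 * ((A x y + A y x) * c - + 4 * (N * N) * (A x y * A y x)) + p * p
      ≡⟨ cong₂ (λ s t → + 2 * (s * c - + 4 * (N * N) * t) + p * p) (A+Aᵀ x y) (no-2-cycle A-oriented x y) ⟩
    + 2 * ((1ℤ - E (q x) (q y)) * c - + 4 * (N * N) * 0ℤ) + p * p
      ≡⟨ cong (λ t → + 2 * t + p * p) (drop ((1ℤ - E (q x) (q y)) * c) (N * N)) ⟩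
    + 2 * ((1ℤ - E (q x) (q y)) * c) + p * p ∎
    where
    c p : ℤ
    c = (N * N - + 2 * N) * (N * N - N) + + 2 * N * (N - N * E (q x) (q y))
    p = N * N - + 2 * N + + 2 * N * E (q x) (q y)

    distribute : ∀ a b s t u w → + 16 * (a * s + (u * w + t * b)) ≡
      + 2 * (a * (+ 8 * s) + b * (+ 8 * t)) + (+ 4 * u) * (+ 4 * w)
    distribute = solve-∀

    collect : ∀ m a b c → a * (c - + 2 * (m * m) * b) + b * (c - + 2 * (m * m) * a) ≡
      (a + b) * c - + 4 * (m * m) * (a * b)
    collect = solve-∀

    drop : ∀ a m → a - + 4 * m * 0ℤ ≡ a
    drop = solve-∀

-- The hypergraphs

2[mC2] : ∀ m → + 2 * + (m C 2) ≡ + m * (+ m - 1ℤ)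
2[mC2] zero    = refl
2[mC2] (suc m) = begin
  + 2 * + (suc m C 2)             ≡⟨ cong (λ c → + 2 * + c) (nCk+nC[k+1]≡[n+1]C[k+1] m 1) ⟨
  + 2 * (+ (m C 1) + + (m C 2))   ≡⟨ cong (λ c → + 2 * (+ c + + (m C 2))) (nC1≡n m) ⟩
  + 2 * (+ m + + (m C 2))         ≡⟨ ℤ.*-distribˡ-+ (+ 2) (+ m) (+ (m C 2)) ⟩
  + 2 * + m + + 2 * + (m C 2)     ≡⟨ cong (ℤ._+_ (+ 2 * + m)) (2[mC2] m) ⟩
  + 2 * + m + + m * (+ m - 1ℤ)    ≡⟨ pascal (+ m) ⟩
  (1ℤ + + m) * (1ℤ + + m - 1ℤ)    ∎
  where
  pascal : ∀ m → + 2 * m + m * (m - 1ℤ) ≡ (1ℤ + m) * (1ℤ + m - 1ℤ)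
  pascal = solve-∀

/≡ℕ→ℚ : ∀ c {P} l → + suc c * + l ≡ P → P ℚ./ suc c ≡ ℕ→ℚ l
/≡ℕ→ℚ c {P} l cl≡P = fromℚᵘ-cong {mkℚᵘ P c} {mkℚᵘ (+ l) 0} (*≡* (begin
  P * 1ℤ         ≡⟨ ℤ.*-identityʳ P ⟩
  P              ≡⟨ cl≡P ⟨
  + suc c * + l  ≡⟨ ℤ.*-comm (+ suc c) (+ l) ⟩
  + l * + suc c  ∎))

-- It suffices that a positive multiple of the degree is constant. Positivity comes from the subset
-- witnessing that `a` is attained: it is a hyperedge, and the degree is taken at one of its
-- vertices.
regular : ∀ {v} (M : Matrix v) k a c {K} → (∀ x → + suc c * + degree (𝓗 M (suc k) a) x ≡ K) →
  D M (suc k) a → ∃[ r ] 0 ℕ.< r × (∀ x → degree (𝓗 M (suc k) a) x ≡ r)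
regular M k a c const (α , ∣α∣ , det≡a) =
  let x , x∈α = inhabited α ∣α∣
  in degree (𝓗 M (suc k) a) x
   , filter-some (λ α → UniformHypergraph.edge? (𝓗 M (suc k) a) α ×-dec (x ∈? α))
       (List.lose (∈-subsets α) ((∣α∣ , det≡a) , x∈α))
   , λ y → ℤ.+-injective (ℤ.*-cancelˡ-≡ (+ suc c) _ _ (trans (const y) (sym (const x))))

-- The parameters are read off as the pair degrees of two sample pairs, so that
-- their integrality needs no argument.
isPBIBD : ∀ {v k} {G : UniformHypergraph v k} {R : Relations v} {P₁ P₂ : ℤ} c₁ c₂ →
  (∃[ r ] 0 ℕ.< r × (∀ x → degree G x ≡ r)) →
  (∃[ x ] ∃[ y ] R (suc zero) x y) → (∃[ x ] ∃[ y ] R (suc (suc zero)) x y) →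
  (∀ x y → R (suc zero) x y → + suc c₁ * + pairDegree G x y ≡ P₁) →
  (∀ x y → R (suc (suc zero)) x y → + suc c₂ * + pairDegree G x y ≡ P₂) →
  ∃[ λ₁ ] ∃[ λ₂ ] just (P₁ ℚ./ suc c₁ , P₂ ℚ./ suc c₂) ≡ just (ℕ→ℚ λ₁ , ℕ→ℚ λ₂) × IsPBIBD R λ₁ λ₂ G
isPBIBD {G = G} {R} c₁ c₂ reg (x₁ , y₁ , r₁) (x₂ , y₂ , r₂) eq₁ eq₂ =
  pairDegree G x₁ y₁ , pairDegree G x₂ y₂ ,
  cong₂ (λ p q → just (p , q)) (/≡ℕ→ℚ c₁ _ (eq₁ x₁ y₁ r₁)) (/≡ℕ→ℚ c₂ _ (eq₂ x₂ y₂ r₂)) ,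
  record
    { regular = reg
    ; pairs₁  = λ x y r → ℤ.+-injective (ℤ.*-cancelˡ-≡ (+ suc c₁) _ _ (trans (eq₁ x y r) (sym (eq₁ x₁ y₁ r₁))))
    ; pairs₂  = λ x y r → ℤ.+-injective (ℤ.*-cancelˡ-≡ (+ suc c₂) _ _ (trans (eq₂ x y r) (sym (eq₂ x₂ y₂ r₂))))
    }

-- The four cases

module PBIBD (m : ℕ) {H : Matrix ((2 ℕ.+ m) ℕ.* (2 ℕ.+ m))} (skewBush : IsSkewBush (2 ℕ.+ m) H) where
  open SkewBush skewBush

  n = 2 ℕ.+ m

  local₃ : ∀ α → ∣ α ∣ ≡ 3 → DetCountsWalks 2 1ℤ (A [ α ])
  local₃ α = det-counts-walks₃ (restrict-oriented A-oriented (elements α))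

  local₄ : ∀ α → ∣ α ∣ ≡ 4 → DetCountsWalks 3 -1ℤ (A [ α ])
  local₄ α = det-counts-walks₄ (restrict-oriented A-oriented (elements α))

  module C₃ = Counting A 1 1ℤ (λ ()) local₃ (simple₃ A-oriented)
  module C₄ = Counting A 2 -1ℤ (λ ()) local₄ (simple₄ A-oriented)

  -- The form `2 ℕ.+ m` of `n` provides the indices 0 and 1, here as two positions in one block and
  -- below as two blocks.
  same-block : ∃[ x ] ∃[ y ] 𝓧₁ n (suc zero) x y
  same-block = combine {n} {n} zero zero , combine {n} {n} zero (suc zero) , (λ ()) ,
    trans (q-combine zero zero) (sym (q-combine zero (suc zero)))

  different-blocks : ∃[ x ] ∃[ y ] 𝓧₁ n (suc (suc zero)) x y
  different-blocks = combine {n} {n} zero zero , combine {n} {n} (suc zero) zero ,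
    λ eq → 0≢1 (trans (sym (q-combine zero zero)) (trans eq (q-combine (suc zero) zero)))
    where
    0≢1 : zero {suc m} ≢ suc zero
    0≢1 ()

  v-2 : + (n ℕ.* n ℕ.∸ 2) ≡ N * N - + 2
  v-2 = begin
    + (n ℕ.* n ℕ.∸ 2)              ≡⟨ add-sub (+ (n ℕ.* n ℕ.∸ 2)) ⟩
    -- The truncated subtraction is exact: `n ℕ.* n` reduces to a double successor.
    + (n ℕ.* n ℕ.∸ 2) + + 2 - + 2  ≡⟨ cong (λ t → + t - + 2) (ℕ.m∸n+n≡m {n ℕ.* n} {2} (s≤s (s≤s z≤n))) ⟩
    + (n ℕ.* n) - + 2              ≡⟨ cong (_- + 2) (ℤ.pos-* n n) ⟩
    N * N - + 2                    ∎
    where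
    add-sub : ∀ a → a ≡ a + + 2 - + 2
    add-sub = solve-∀

  subtract : ∀ a b {c} → a + b ≡ c → a ≡ c - b
  subtract a b refl = cancel a b
    where
    cancel : ∀ a b → a ≡ a + b - b
    cancel = solve-∀

  same : ∀ x y → q x ≡ q y → E (q x) (q y) ≡ 1ℤ
  same x y = 𝟙-true (q x Fin.≟ q y)

  different : ∀ x y → q x ≢ q y → E (q x) (q y) ≡ 0ℤ
  different x y = 𝟙-false (q x Fin.≟ q y)

  distinct : ∀ x y → q x ≢ q y → x ≢ y
  distinct x y qx≢qy x≡y = qx≢qy (cong q x≡y)

  visits₃-same : ∀ x y → x ≢ y → q x ≡ q y → + 4 * visits A y 2 x x ≡ 0ℤ
  visits₃-same x y x≢y eq = trans (4visits-2 x y x≢y)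
    (cong (λ e → (1ℤ - e) * (N * N - + 2 * N + + 2 * N * e)) (same x y eq))

  visits₃-different : ∀ x y → q x ≢ q y → + 4 * visits A y 2 x x ≡ N * (N - + 2)
  visits₃-different x y neq = trans (4visits-2 x y (distinct x y neq))
    (trans (cong (λ e → (1ℤ - e) * (N * N - + 2 * N + + 2 * N * e)) (different x y neq)) (value N))
    where
    value : ∀ m → (1ℤ - 0ℤ) * (m * m - + 2 * m + + 2 * m * 0ℤ) ≡ m * (m - + 2)
    value = solve-∀

  visits₄-same : ∀ x y → x ≢ y → q x ≡ q y → + 16 * visits A y 3 x x ≡ N ^ 4
  visits₄-same x y x≢y eq = trans (16visits-3 x y x≢y) (trans
    (cong (λ e → + 2 * ((1ℤ - e) * ((N * N - + 2 * N) * (N * N - N) + + 2 * N * (N - N * e))) +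
                 (N * N - + 2 * N + + 2 * N * e) * (N * N - + 2 * N + + 2 * N * e)) (same x y eq)) (value N))
    where
    -- The right-hand side is `N ^ 4` unfolded, so that the ring solver sees only products.
    value : ∀ m → + 2 * ((1ℤ - 1ℤ) * ((m * m - + 2 * m) * (m * m - m) + + 2 * m * (m - m * 1ℤ))) +
      (m * m - + 2 * m + + 2 * m * 1ℤ) * (m * m - + 2 * m + + 2 * m * 1ℤ) ≡ m * (m * (m * (m * 1ℤ)))
    value = solve-∀

  visits₄-different : ∀ x y → q x ≢ q y →
    + 16 * visits A y 3 x x ≡ N ^ 2 * (+ 3 * N ^ 2 - + 10 * N + + 12)
  visits₄-different x y neq = trans (16visits-3 x y (distinct x y neq)) (trans
    (cong (λ e → + 2 * ((1ℤ - e) * ((N * N - + 2 * N) * (N * N - N) + + 2 * N * (N - N * e))) +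
                 (N * N - + 2 * N + + 2 * N * e) * (N * N - + 2 * N + + 2 * N * e)) (different x y neq)) (value N))
    where
    value : ∀ m → + 2 * ((1ℤ - 0ℤ) * ((m * m - + 2 * m) * (m * m - m) + + 2 * m * (m - m * 0ℤ))) +
      (m * m - + 2 * m + + 2 * m * 0ℤ) * (m * m - + 2 * m + + 2 * m * 0ℤ) ≡
      m * (m * 1ℤ) * (+ 3 * (m * (m * 1ℤ)) - + 10 * m + + 12)
    value = solve-∀

  Conclusion : ℕ → ℤ → Set
  Conclusion k a = ∃[ λ₁ ] ∃[ λ₂ ]
    parameters n k a ≡ just (ℕ→ℚ λ₁ , ℕ→ℚ λ₂) × IsPBIBD (𝓧₁ n) λ₁ λ₂ (𝓗 A k a)

  case-3-1 : D A 3 1ℤ → Conclusion 3 1ℤ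
  -- Denominators and multipliers are passed as predecessors: 0 and 3 stand for 1 and 4, and 7 for
  -- the factor 8 of `closed-3-walks`. As the first denominator is 1, the factor 4 of `visits₃-same`
  -- is cancelled.
  case-3-1 1∈D = isPBIBD {G = 𝓗 A 3 1ℤ} {𝓧₁ n} 0 3
    (regular A 2 1ℤ 7 (λ x → trans (cong (+ 8 *_) (C₃.degree-b x)) (closed-3-walks x)) 1∈D)
    same-block different-blocks
    (λ x y (x≢y , eq) → trans (ℤ.*-identityˡ (+ pairDegree (𝓗 A 3 1ℤ) x y)) (ℤ.*-cancelˡ-≡ (+ 4) _ 0ℤ (trans
      (cong (+ 4 *_) (C₃.pairDegree-b x y x≢y)) (visits₃-same x y x≢y eq))))
    (λ x y neq → trans (cong (+ 4 *_) (C₃.pairDegree-b x y (distinct x y neq))) (visits₃-different x y neq))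

  pairDegree₃-0 : ∀ x y → x ≢ y →
    + 4 * + pairDegree (𝓗 A 3 0ℤ) x y ≡ + 4 * (N * N - + 2) - + 4 * visits A y 2 x x
  pairDegree₃-0 x y x≢y = begin
    + 4 * + pairDegree (𝓗 A 3 0ℤ) x y
      ≡⟨ cong (+ 4 *_) (subtract _ (visits A y 2 x x) (C₃.pairDegree-0 x y x≢y)) ⟩
    + 4 * (+ ((n ℕ.* n ℕ.∸ 2) C 1) - visits A y 2 x x)
      ≡⟨ cong (λ c → + 4 * (c - visits A y 2 x x)) (trans (cong +_ (nC1≡n (n ℕ.* n ℕ.∸ 2))) v-2) ⟩
    + 4 * (N * N - + 2 - visits A y 2 x x)
      ≡⟨ distribute (N * N - + 2) (visits A y 2 x x) ⟩
    + 4 * (N * N - + 2) - + 4 * visits A y 2 x x ∎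
    where
    distribute : ∀ a b → + 4 * (a - b) ≡ + 4 * a - + 4 * b
    distribute = solve-∀

  case-3-0 : D A 3 0ℤ → Conclusion 3 0ℤ
  case-3-0 0∈D = isPBIBD {G = 𝓗 A 3 0ℤ} {𝓧₁ n} 0 3
    -- Only constancy of the degree is needed, so the binomial coefficient stays unevaluated.
    (regular A 2 0ℤ 7 (λ x → trans (cong (+ 8 *_) (subtract _ (walks A 2 x x) (C₃.degree-0 x)))
      (trans (distribute (+ ((n ℕ.* n ℕ.∸ 1) C 2)) (walks A 2 x x))
        (cong (λ t → + 8 * + ((n ℕ.* n ℕ.∸ 1) C 2) - t) (closed-3-walks x)))) 0∈D)
    same-block different-blocks
    (λ x y (x≢y , eq) → trans (ℤ.*-identityˡ (+ pairDegree (𝓗 A 3 0ℤ) x y)) (ℤ.*-cancelˡ-≡ (+ 4) _ (N ^ 2 - + 2)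
      (trans (pairDegree₃-0 x y x≢y) (trans (cong (λ t → + 4 * (N * N - + 2) - t) (visits₃-same x y x≢y eq)) (value₁ N)))))
    (λ x y neq → trans (pairDegree₃-0 x y (distinct x y neq))
      (trans (cong (λ t → + 4 * (N * N - + 2) - t) (visits₃-different x y neq)) (value₂ N)))
    where
    distribute : ∀ a b → + 8 * (a - b) ≡ + 8 * a - + 8 * b
    distribute = solve-∀

    value₁ : ∀ m → + 4 * (m * m - + 2) - 0ℤ ≡ + 4 * (m * (m * 1ℤ) - + 2)
    value₁ = solve-∀

    value₂ : ∀ m → + 4 * (m * m - + 2) - m * (m - + 2) ≡ (+ 3 * m - + 4) * (m + + 2)
    value₂ = solve-∀

  case-4--1 : D A 4 -1ℤ → Conclusion 4 -1ℤ
  case-4--1 -1∈D = isPBIBD {G = 𝓗 A 4 -1ℤ} {𝓧₁ n} 15 15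
    (regular A 3 -1ℤ 15 (λ x → trans (cong (+ 16 *_) (C₄.degree-b x)) (closed-4-walks x)) -1∈D)
    same-block different-blocks
    (λ x y (x≢y , eq) → trans (cong (+ 16 *_) (C₄.pairDegree-b x y x≢y)) (visits₄-same x y x≢y eq))
    (λ x y neq → trans (cong (+ 16 *_) (C₄.pairDegree-b x y (distinct x y neq))) (visits₄-different x y neq))

  pairDegree₄-0 : ∀ x y → x ≢ y →
    + 16 * + pairDegree (𝓗 A 4 0ℤ) x y ≡ + 8 * ((N * N - + 2) * (N * N - + 2 - 1ℤ)) - + 16 * visits A y 3 x x
  pairDegree₄-0 x y x≢y = begin
    + 16 * + pairDegree (𝓗 A 4 0ℤ) x y
      ≡⟨ cong (+ 16 *_) (subtract _ (visits A y 3 x x) (C₄.pairDegree-0 x y x≢y)) ⟩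
    + 16 * (+ ((n ℕ.* n ℕ.∸ 2) C 2) - visits A y 3 x x)
      ≡⟨ distribute (+ ((n ℕ.* n ℕ.∸ 2) C 2)) (visits A y 3 x x) ⟩
    -- Splitting 16 as 8 times 2 lets `2[mC2]` turn the binomial coefficient into a polynomial.
    + 8 * (+ 2 * + ((n ℕ.* n ℕ.∸ 2) C 2)) - + 16 * visits A y 3 x x
      ≡⟨ cong (λ t → + 8 * t - + 16 * visits A y 3 x x) (trans (2[mC2] (n ℕ.* n ℕ.∸ 2)) (cong (λ t → t * (t - 1ℤ)) v-2)) ⟩
    + 8 * ((N * N - + 2) * (N * N - + 2 - 1ℤ)) - + 16 * visits A y 3 x x ∎
    where
    distribute : ∀ a b → + 16 * (a - b) ≡ + 8 * (+ 2 * a) - + 16 * b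
    distribute = solve-∀

  case-4-0 : D A 4 0ℤ → Conclusion 4 0ℤ
  case-4-0 0∈D = isPBIBD {G = 𝓗 A 4 0ℤ} {𝓧₁ n} 15 15
    (regular A 3 0ℤ 15 (λ x → trans (cong (+ 16 *_) (subtract _ (walks A 3 x x) (C₄.degree-0 x)))
      (trans (distribute (+ ((n ℕ.* n ℕ.∸ 1) C 3)) (walks A 3 x x))
        (cong (λ t → + 16 * + ((n ℕ.* n ℕ.∸ 1) C 3) - t) (closed-4-walks x)))) 0∈D)
    same-block different-blocks
    (λ x y (x≢y , eq) → trans (pairDegree₄-0 x y x≢y)
      (trans (cong (λ t → + 8 * ((N * N - + 2) * (N * N - + 2 - 1ℤ)) - t) (visits₄-same x y x≢y eq)) (value₁ N)))
    (λ x y neq → trans (pairDegree₄-0 x y (distinct x y neq))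
      (trans (cong (λ t → + 8 * ((N * N - + 2) * (N * N - + 2 - 1ℤ)) - t) (visits₄-different x y neq)) (value₂ N)))
    where
    distribute : ∀ a b → + 16 * (a - b) ≡ + 16 * a - + 16 * b
    distribute = solve-∀

    value₁ : ∀ m → + 8 * ((m * m - + 2) * (m * m - + 2 - 1ℤ)) - m * (m * (m * (m * 1ℤ))) ≡
             (m - + 2) * (m + + 2) * (+ 7 * (m * (m * 1ℤ)) - + 12)
    value₁ = solve-∀

    value₂ : ∀ m → + 8 * ((m * m - + 2) * (m * m - + 2 - 1ℤ)) -
                   m * (m * 1ℤ) * (+ 3 * (m * (m * 1ℤ)) - + 10 * m + + 12) ≡
             (m - + 2) * (+ 5 * (m * (m * (m * 1ℤ))) + + 20 * (m * (m * 1ℤ)) - + 12 * m - + 24)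
    value₂ = solve-∀

  -- The subset attaining `a` has determinant 0 or the nonzero value for its size, so `a` falls
  -- under one of the four listed cases.
  conclusion : ∀ k → k ≡ 3 ⊎ k ≡ 4 → ∀ a → D A k a → Conclusion k a
  conclusion _ (inj₁ refl) a a∈D@(α , ∣α∣ , det≡a) with DetCountsWalks.det∈ (local₃ α ∣α∣)
  ... | inj₁ det≡0 with refl ← trans (sym det≡a) det≡0 = case-3-0 a∈D
  ... | inj₂ det≡1 with refl ← trans (sym det≡a) det≡1 = case-3-1 a∈D
  conclusion _ (inj₂ refl) a a∈D@(α , ∣α∣ , det≡a) with DetCountsWalks.det∈ (local₄ α ∣α∣)
  ... | inj₁ det≡0 with refl ← trans (sym det≡a) det≡0 = case-4-0 a∈D
  ... | inj₂ det≡-1 with refl ← trans (sym det≡a) det≡-1 = case-4--1 a∈D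

corollary3p7 :
    (n : ℕ) → 2 ℕ.≤ n →
    (H : Matrix (n ℕ.* n)) → IsSkewBush n H →
    (k : ℕ) → k ≡ 3 ⊎ k ≡ 4 →
    (a : ℤ) → a Unary.∈ D [J- H ]/2 k →
    ∃[ λ₁ ] ∃[ λ₂ ]
      parameters n k a ≡ just (ℕ→ℚ λ₁ , ℕ→ℚ λ₂)
      × IsPBIBD (𝓧₁ n) λ₁ λ₂ (𝓗 [J- H ]/2 k a)
corollary3p7 (suc (suc m)) (s≤s (s≤s z≤n)) H skewBush = PBIBD.conclusion m skewBush
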